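{- Let $T\subset\mathbb{R}^d$ be a finite training set, each point of $T$ having a known classification, and let $R\subseteq T$ be the set of points that the relevant-points algorithm identifies on input $T$. The relevant-points algorithm identifies all relevant points with respect to the whole training set $T$, and with respect to the set $R$ of points that it identifies.
   Context: Classifications are discrete; they are not assumed to be binary, and $T$ is not assumed to be in general position. Nearest-neighbor classification: from a set of classified points, the classification of a point of $\mathbb{R}^d$ is inferred to be the classification of the nearest point (in Euclidean distance) of the set. A point of a set $X$ of classified points is relevant with respect to $X$ if removing it from $X$ would change the nearest-neighbor classification of some points of $\mathbb{R}^d$. A Euclidean minimum spanning tree of $T$ is a minimum spanning tree of the complete graph on $T$ with edges weighted by Euclidean distance (equal distances are allowed, so there may be more than one). The extreme points of a finite set are the vertices of its convex hull. Inversion through the unit sphere centered at $r$ maps $x\ne r$ to $r+(x-r)/\|x-r\|^2$. The relevant-points algorithm, on input $T$: (1) Find a Euclidean minimum spanning tree of $T$. (2) Find the tree edges whose two endpoints have different classifications, and initialize the set $R$ of relevant points to consist of the endpoints of these edges. (3) For each relevant point $r$ added to $R$ (either initially or within this loop): (a) invert through the unit sphere centered at $r$ all of the training points whose classification differs from that of $r$, producing a point set $S_r$, including also $r$ itself in $S_r$; (b) identify the extreme points of $S_r$; (c) add to $R$ the training points corresponding to extreme points of $S_r$. The points identified by the algorithm are the points of the final set $R$. -}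

module Defs where

open import Level using (0ℓ) renaming (suc to lsuc)
open import Algebra.Bundles using (CommutativeRing)
open import Data.Bool.Base using (Bool; true; false; if_then_else_; _∧_)
open import Data.Fin.Base using (Fin; zero; suc; inject₁; fromℕ)
open import Data.Fin.Properties using (_<?_)
open import Data.Nat.Base as ℕ using (ℕ)
open import Data.Product.Base using (∃; ∃-syntax; Σ-syntax; _×_)
open import Data.Vec.Functional using (Vector)
open import Data.Vec.Functional.Relation.Binary.Pointwise using (Pointwise)
open import Function.Definitions using (Injective)
open import Relation.Binary.Core using (Rel)
open import Relation.Binary.Construct.Closure.ReflexiveTransitive using (Star)
open import Relation.Binary.PropositionalEquality.Core using (_≡_; _≢_)
open import Relation.Binary.Structures using (IsTotalOrder)
open import Relation.Nullary.Decidable.Core using (⌊_⌋)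
open import Relation.Nullary.Negation.Core using (¬_)
open import Relation.Unary using (Pred; _∈_)
import Algebra.Properties.CommutativeMonoid.Sum as Sum
import Relation.Binary.Construct.NonStrictToStrict as Strict

-- The real numbers, axiomatised as a (Dedekind-)complete ordered field.
-- Equality is a setoid equality because Agda has no quotient types.
-- As usual for total conventions, x ⁻¹ is unspecified at x ≈ 0 and √ x is
-- unspecified for x < 0; where they are specified, the inverse and the root
-- are determined up to _≈_ by the rest, and every complete ordered field has
-- square roots of its nonnegative elements.
record RealNumbers : Set (lsuc 0ℓ) where
  infix  4 _≤_
  infix  8 _⁻¹ √_
  field
    commutativeRing : CommutativeRing 0ℓ 0ℓ

  open CommutativeRing commutativeRing public

  field
    0≉1          : ¬ (0# ≈ 1#)
    _⁻¹          : Carrier → Carrier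
    *-inverseˡ   : ∀ x → ¬ (x ≈ 0#) → x ⁻¹ * x ≈ 1#
    _≤_          : Rel Carrier 0ℓ
    isTotalOrder : IsTotalOrder _≈_ _≤_
    +-monoˡ-≤    : ∀ z {x y} → x ≤ y → x + z ≤ y + z
    *-nonneg     : ∀ {x y} → 0# ≤ x → 0# ≤ y → 0# ≤ x * y

  UpperBound : Pred Carrier 0ℓ → Pred Carrier 0ℓ
  UpperBound P u = ∀ x → x ∈ P → x ≤ u

  field
    supremum : (P : Pred Carrier 0ℓ) → ∃ P → ∃ (UpperBound P) →
               ∃[ s ] (UpperBound P s × (∀ u → UpperBound P u → s ≤ u))
    √_       : Carrier → Carrier
    √-nonneg : ∀ {x} → 0# ≤ x → 0# ≤ √ x
    √-square : ∀ {x} → 0# ≤ x → √ x * √ x ≈ x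

  open Strict _≈_ _≤_ public using (_<_)
  open Sum +-commutativeMonoid public using (sum)

record Graph (n : ℕ) : Set where
  field
    adj        : Fin n → Fin n → Bool
    adj-sym    : ∀ i j → adj i j ≡ adj j i
    adj-irrefl : ∀ i → adj i i ≡ false

  Adj : Rel (Fin n) 0ℓ
  Adj i j = adj i j ≡ true

  Connected : Set
  Connected = ∀ i j → Star Adj i j

  record Cycle : Set where
    field
      k           : ℕ
      vertex      : Fin (3 ℕ.+ k) → Fin n
      distinct    : Injective _≡_ _≡_ vertex
      consecutive : ∀ i → Adj (vertex (inject₁ i)) (vertex (suc i))
      closing     : Adj (vertex (fromℕ (2 ℕ.+ k))) (vertex zero)

  IsTree : Set
  IsTree = Connected × ¬ Cycle

module NearestNeighbor (ℝ : RealNumbers) where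

  open RealNumbers ℝ

  Point : ℕ → Set
  Point d = Vector Carrier d

  infix 4 _≋_
  _≋_ : ∀ {d} → Rel (Point d) 0ℓ
  _≋_ = Pointwise _≈_

  ‖_-_‖² : ∀ {d} → Point d → Point d → Carrier
  ‖ x - y ‖² = sum λ k → (x k - y k) * (x k - y k)

  dist : ∀ {d} → Point d → Point d → Carrier
  dist x y = √ ‖ x - y ‖²

  invert : ∀ {d} → Point d → Point d → Point d
  invert r x k = r k + (x k - r k) * ‖ x - r ‖² ⁻¹

  ConvexHull : ∀ {d} → Pred (Point d) 0ℓ → Pred (Point d) 0ℓ
  ConvexHull {d} S y =
    Σ[ m ∈ ℕ ] Σ[ p ∈ Vector (Point d) m ] Σ[ w ∈ Vector Carrier m ]
      (∀ j → p j ∈ S) ×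
      (∀ j → 0# ≤ w j) ×
      sum w ≈ 1# ×
      y ≋ (λ k → sum λ j → w j * p j k)

  -- For finite S these are the vertices of the polytope ConvexHull S; they
  -- automatically belong to S.
  Extreme : ∀ {d} → Pred (Point d) 0ℓ → Pred (Point d) 0ℓ
  Extreme S y =
    y ∈ ConvexHull S ×
    (∀ a b t → a ∈ ConvexHull S → b ∈ ConvexHull S → 0# < t → t < 1# →
      y ≋ (λ k → (1# - t) * a k + t * b k) → a ≋ b)

  -- A set of n distinct points of ℝ^d with classifications in K.  Subsets of
  -- the training set are predicates on the index type Fin n.
  record TrainingSet (d n : ℕ) (K : Set) : Set where
    field
      point    : Fin n → Point d
      distinct : Injective _≡_ _≋_ point
      class    : Fin n → K

  module _ {d n : ℕ} {K : Set} (T : TrainingSet d n K) where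

    open TrainingSet T

    Nearest : Pred (Fin n) 0ℓ → Point d → Pred (Fin n) 0ℓ
    Nearest X q i = i ∈ X × (∀ j → j ∈ X → dist q (point i) ≤ dist q (point j))

    -- There is no inferred classification at points where nearest points of
    -- different classes tie, nor when X is empty.
    Inferred : Pred (Fin n) 0ℓ → Point d → K → Set
    Inferred X q c = ∃ (Nearest X q) × (∀ i → i ∈ Nearest X q → class i ≡ c)

    _∖_ : Pred (Fin n) 0ℓ → Fin n → Pred (Fin n) 0ℓ
    (X ∖ r) i = i ∈ X × i ≢ r

    Relevant : Pred (Fin n) 0ℓ → Pred (Fin n) 0ℓ
    Relevant X r =
      r ∈ X ×
      ∃[ q ] ∃[ c ] ∃[ c′ ] Inferred X q c × Inferred (X ∖ r) q c′ × c ≢ c′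

    weight : Graph n → Carrier
    weight G = sum λ i → sum λ j →
      if ⌊ i <? j ⌋ ∧ Graph.adj G i j then dist (point i) (point j) else 0#

    IsEuclideanMST : Graph n → Set
    IsEuclideanMST G =
      Graph.IsTree G × (∀ H → Graph.IsTree H → weight G ≤ weight H)

    -- SPoint r i y: the training point i corresponds to the point y of S_r.
    data SPoint (r i : Fin n) (y : Point d) : Set where
      centre   : i ≡ r → y ≋ point r → SPoint r i y
      inverted : class i ≢ class r → y ≋ invert (point r) (point i) →
                 SPoint r i y

    S : Fin n → Pred (Point d) 0ℓ
    S r y = ∃[ i ] SPoint r i y

    -- The final set R of the algorithm run with the spanning tree G.  Every
    -- point added to R is eventually processed, so R is the least set that
    -- contains the initial points and is closed under the loop body.
    data Identified (G : Graph n) : Pred (Fin n) 0ℓ where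
      initial : ∀ {i j} → Graph.Adj G i j → class i ≢ class j → Identified G i
      step    : ∀ {r i} y → Identified G r → SPoint r i y → Extreme (S r) y →
                Identified G i

{-# OPTIONS --safe #-}
module Submission where

open import Defs
open import Level using (0ℓ)
open import Algebra.Bundles using (CommutativeRing)
open import Algebra.Solver.Ring.AlmostCommutativeRing using (fromCommutativeRing; _-Raw-AlmostCommutative⟶_)
open import Axiom.ExcludedMiddle using (ExcludedMiddle)
open import Data.Bool.Base using (false; true; if_then_else_; _∧_)
open import Data.Bool.Properties using (¬-not)
open import Data.Fin.Base as Fin using (Fin; zero; suc; inject₁; fromℕ)
open import Data.Fin.Induction using (<-weakInduction)
open import Data.Fin.Properties using (_≟_; _<?_; <-asym; <-cmp; suc-injective; fromℕ≢inject₁)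
open import Data.Integer.Base as ℤ using (ℤ; +_; -[1+_])
open import Data.List.Base as List using (List; []; allFin; cartesianProduct)
open import Data.List.Membership.Propositional.Properties using (∈-cartesianProduct⁺; ∈-allFin)
open import Data.List.Relation.Unary.Any using (here; there)
open import Data.Nat.Base as ℕ using (ℕ; zero; suc)
open import Data.Product.Base using (_×_; _,_; proj₁; proj₂; ∃; ∃-syntax; Σ-syntax)
open import Data.Sum.Base as Sum using (_⊎_; inj₁; inj₂)
open import Data.Vec.Functional using (Vector; _∷_)
open import Function.Base using (_∘_; id)
open import Function.Bundles using (_⇔_; mk⇔)
open import Relation.Binary.Construct.Closure.ReflexiveTransitive as Star using (Star; ε; _◅_; _◅◅_; _⋆)
open import Relation.Binary.Core using (Rel)
open import Relation.Binary.Definitions using (tri<; tri≈; tri>)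
open import Relation.Binary.PropositionalEquality.Core as ≡ using (_≡_; _≢_)
open import Relation.Binary.Structures using (IsTotalOrder)
open import Relation.Nullary.Decidable.Core using (Dec; yes; no; ⌊_⌋; dec⇒maybe)
open import Relation.Nullary.Negation.Core using (¬_; contradiction)
open import Relation.Unary using (Pred; U; _∈_)
import Algebra.Properties.AbelianGroup as AbelianGroupProperties
import Algebra.Properties.Ring as RingProperties
import Algebra.Properties.Semiring.Mult.TCOptimised as Mult
import Algebra.Properties.Semiring.Sum as SemiringSum
import Algebra.Solver.Ring as RingSolver
import Data.Integer.Properties as ℤ
import Data.List.Membership.Propositional as List
import Data.Maybe.Base as Maybe
import Data.Sign.Base as Sign
import Relation.Binary.Construct.NonStrictToStrict as Strict
import Relation.Binary.Reasoning.Setoid as SetoidReasoning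

-- A point r is identified together with enough points of other classes to decide
-- where r beats all of them: for D the squared distance and x′ the inverse of x,
-- D(q, x) - D(q, r) is a positive multiple of 1 - 2⟨q - r, x′ - r⟩, and the linear
-- functional ⟨q - r, _⟩ attains its maximum over S_r at an extreme point.  Hence if t
-- is nearest to q among the identified points, no training point of another class is
-- nearer to q than t.  A relevant point omitted by the algorithm would contradict
-- this, so for this half the spanning tree is needed only to start the loop.
--
-- Conversely, an extreme point s′ of S_r is exposed (Farkas), so some sphere through r
-- and s encloses no further point of a class other than that of r; sliding its centre
-- towards s shows the relevance of s.  The endpoints of a tree edge have such a
-- sphere too, with the edge as diameter, because of the exchange property.

-- A tie between classes has no inferred classification, so the centre of a sphere through r and s
-- is not itself a witness of relevance. The usable condition is a wall for s against r: a centre u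
-- with D(u, r) ≤ D(u, s) such that every other point of a class different from that of r is
-- strictly farther from u than s. Points of the class of r may lie anywhere, and strictness leaves
-- room to move the centre. Tree edges and extreme points both deliver walls, so one lemma serves
-- both. A wall holds against all of T, hence inside R once r and s lie in R.
--
-- Without general position a linear functional may attain its maximum over S_r at many points, so a
-- second functional has to break ties. The point r belongs to S_r for two reasons: if it is the
-- maximiser, ⟨q - r, _ - r⟩ is bounded by 0, below the threshold 1/2; and it forces a functional
-- separating s′ from the rest to be positive at s′ relative to r, so that it can be scaled to this
-- threshold.

-- Integer coefficients for the ring solver.

module IntegerCoefficients (R : CommutativeRing 0ℓ 0ℓ) where
  open CommutativeRing R
  open Mult semiring using (×-homo-+; ×1-homo-*; 1+×) renaming (_×_ to _·_)
  open RingProperties ring using (-‿distribˡ-*; -‿distribʳ-*; -0#≈0#; -‿involutive)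
  open AbelianGroupProperties +-abelianGroup using (⁻¹-∙-comm)
  open SetoidReasoning setoid

  -- Equality of ring elements cannot be decided by computation, so the solver normalises with
  -- integer coefficients mapped into the ring. With these multiples `⟦ + 2 ⟧` unfolds to `1# + 1#`
  -- without a stray `0#`, so `con (+ 2)` matches `2#` literally.
  ⟦_⟧ : ℤ → Carrier
  ⟦ + n ⟧      = n · 1#
  ⟦ -[1+ n ] ⟧ = - (suc n · 1#)

  ⟦⟧-homo-⊖ : ∀ m n → ⟦ m ℤ.⊖ n ⟧ ≈ m · 1# - n · 1#
  ⟦⟧-homo-⊖ m       zero    = sym (trans (+-congˡ -0#≈0#) (+-identityʳ _))
  ⟦⟧-homo-⊖ zero    (suc n) = sym (+-identityˡ _)
  ⟦⟧-homo-⊖ (suc m) (suc n) = begin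
    ⟦ suc m ℤ.⊖ suc n ⟧                    ≡⟨ ≡.cong ⟦_⟧ (ℤ.[1+m]⊖[1+n]≡m⊖n m n) ⟩
    ⟦ m ℤ.⊖ n ⟧                            ≈⟨ ⟦⟧-homo-⊖ m n ⟩
    m · 1# - n · 1#                        ≈⟨ +-congʳ (+-identityˡ _) ⟨
    (0# + m · 1#) - n · 1#                 ≈⟨ +-congʳ (+-congʳ (-‿inverseʳ 1#)) ⟨
    (1# - 1# + m · 1#) - n · 1#            ≈⟨ +-congʳ (+-assoc _ _ _) ⟩
    (1# + (- 1# + m · 1#)) - n · 1#        ≈⟨ +-congʳ (+-congˡ (+-comm _ _)) ⟩
    (1# + (m · 1# - 1#)) - n · 1#          ≈⟨ +-congʳ (+-assoc _ _ _) ⟨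
    ((1# + m · 1#) - 1#) - n · 1#          ≈⟨ +-assoc _ _ _ ⟩
    (1# + m · 1#) + (- 1# - n · 1#)        ≈⟨ +-congˡ (⁻¹-∙-comm _ _) ⟩
    (1# + m · 1#) - (1# + n · 1#)          ≈⟨ +-cong (1+× m 1#) (-‿cong (1+× n 1#)) ⟨
    suc m · 1# - suc n · 1#                ∎

  ⟦⟧-homo-+ : ∀ i j → ⟦ i ℤ.+ j ⟧ ≈ ⟦ i ⟧ + ⟦ j ⟧
  ⟦⟧-homo-+ (+ m)    (+ n)    = ×-homo-+ 1# m n
  ⟦⟧-homo-+ (+ m)    -[1+ n ] = ⟦⟧-homo-⊖ m (suc n)
  ⟦⟧-homo-+ -[1+ m ] (+ n)    = trans (⟦⟧-homo-⊖ n (suc m)) (+-comm _ _)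
  ⟦⟧-homo-+ -[1+ m ] -[1+ n ] = begin
    - (suc (suc (m ℕ.+ n)) · 1#)         ≈⟨ -‿cong (1+× (suc (m ℕ.+ n)) 1#) ⟩
    - (1# + (suc m ℕ.+ n) · 1#)          ≈⟨ -‿cong (+-congˡ (×-homo-+ 1# (suc m) n)) ⟩
    - (1# + (suc m · 1# + n · 1#))       ≈⟨ -‿cong (+-comm _ _) ⟩
    - ((suc m · 1# + n · 1#) + 1#)       ≈⟨ -‿cong (+-assoc _ _ _) ⟩
    - (suc m · 1# + (n · 1# + 1#))       ≈⟨ -‿cong (+-congˡ (+-comm _ _)) ⟩
    - (suc m · 1# + (1# + n · 1#))       ≈⟨ -‿cong (+-congˡ (1+× n 1#)) ⟨
    - (suc m · 1# + suc n · 1#)          ≈⟨ ⁻¹-∙-comm _ _ ⟨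
    - (suc m · 1#) - suc n · 1#          ∎

  ⟦⟧-homo-- : ∀ i → ⟦ ℤ.- i ⟧ ≈ - ⟦ i ⟧
  ⟦⟧-homo-- (+ zero)  = sym -0#≈0#
  ⟦⟧-homo-- (+ suc n) = refl
  ⟦⟧-homo-- -[1+ n ]  = sym (-‿involutive _)

  ⟦⟧-◃+ : ∀ n → ⟦ Sign.+ ℤ.◃ n ⟧ ≈ n · 1#
  ⟦⟧-◃+ zero    = refl
  ⟦⟧-◃+ (suc n) = refl

  ⟦⟧-◃- : ∀ n → ⟦ Sign.- ℤ.◃ n ⟧ ≈ - (n · 1#)
  ⟦⟧-◃- zero    = sym -0#≈0#
  ⟦⟧-◃- (suc n) = refl

  ⟦⟧-homo-* : ∀ i j → ⟦ i ℤ.* j ⟧ ≈ ⟦ i ⟧ * ⟦ j ⟧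
  ⟦⟧-homo-* (+ m)    (+ n)    = trans (⟦⟧-◃+ (m ℕ.* n)) (×1-homo-* m n)
  ⟦⟧-homo-* (+ m)    -[1+ n ] = trans (⟦⟧-◃- (m ℕ.* suc n))
    (trans (-‿cong (×1-homo-* m (suc n))) (-‿distribʳ-* _ _))
  ⟦⟧-homo-* -[1+ m ] (+ n)    = trans (⟦⟧-◃- (suc m ℕ.* n))
    (trans (-‿cong (×1-homo-* (suc m) n)) (-‿distribˡ-* _ _))
  ⟦⟧-homo-* -[1+ m ] -[1+ n ] = begin
    (suc m ℕ.* suc n) · 1#                  ≈⟨ ×1-homo-* (suc m) (suc n) ⟩
    (suc m · 1#) * (suc n · 1#)             ≈⟨ -‿involutive _ ⟨
    - - ((suc m · 1#) * (suc n · 1#))       ≈⟨ -‿cong (-‿distribˡ-* _ _) ⟩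
    - (- (suc m · 1#) * (suc n · 1#))       ≈⟨ -‿distribʳ-* _ _ ⟩
    - (suc m · 1#) * - (suc n · 1#)         ∎

  morphism : ℤ.+-*-rawRing -Raw-AlmostCommutative⟶ fromCommutativeRing R
  morphism = record
    { ⟦_⟧    = ⟦_⟧
    ; +-homo = ⟦⟧-homo-+
    ; *-homo = ⟦⟧-homo-*
    ; -‿homo = ⟦⟧-homo--
    ; 0-homo = refl
    ; 1-homo = refl
    }

  module Solver = RingSolver ℤ.+-*-rawRing (fromCommutativeRing R) morphism
    (λ i j → Maybe.map (reflexive ∘ ≡.cong ⟦_⟧) (dec⇒maybe (i ℤ.≟ j)))

-- Order, square roots, finite sums and squared distances.

module OrderedField (em : ExcludedMiddle 0ℓ) (ℝ : RealNumbers) where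
  open RealNumbers ℝ hiding (zero)
  open NearestNeighbor ℝ
  open IntegerCoefficients.Solver commutativeRing
  open SemiringSum semiring using (sum-cong-≋; ∑-distrib-+; *-distribˡ-sum)
  open SetoidReasoning setoid
  open IsTotalOrder isTotalOrder public using (total; antisym)
    renaming (refl to ≤-refl; reflexive to ≤-reflexive; trans to ≤-trans)

  2# : Carrier
  2# = 1# + 1#

  ≤-respʳ : ∀ {x y z} → y ≈ z → x ≤ y → x ≤ z
  ≤-respʳ y≈z x≤y = ≤-trans x≤y (≤-reflexive y≈z)

  ≤-respˡ : ∀ {x y z} → x ≈ y → x ≤ z → y ≤ z
  ≤-respˡ x≈y x≤z = ≤-trans (≤-reflexive (sym x≈y)) x≤z

  <⇒≤ : ∀ {x y} → x < y → x ≤ y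
  <⇒≤ = proj₁

  <⇒≱ : ∀ {x y} → x < y → ¬ y ≤ x
  <⇒≱ = Strict.<⇒≱ _≈_ _≤_ antisym

  ≰⇒> : ∀ {x y} → ¬ x ≤ y → y < x
  ≰⇒> = Strict.≰⇒> _≈_ _≤_ sym ≤-reflexive total

  ≤∧≉⇒< : ∀ {x y} → x ≤ y → ¬ x ≈ y → x < y
  ≤∧≉⇒< = _,_

  <-≤-trans : ∀ {x y z} → x < y → y ≤ z → x < z
  <-≤-trans x<y y≤z = ≰⇒> λ z≤x → <⇒≱ x<y (≤-trans y≤z z≤x)

  ≤-<-trans : ∀ {x y z} → x ≤ y → y < z → x < z
  ≤-<-trans x≤y y<z = ≰⇒> λ z≤x → <⇒≱ y<z (≤-trans z≤x x≤y)

  <-respʳ : ∀ {x y z} → y ≈ z → x < y → x < z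
  <-respʳ y≈z x<y = <-≤-trans x<y (≤-reflexive y≈z)

  pos⇒≉0 : ∀ {x} → 0# < x → ¬ x ≈ 0#
  pos⇒≉0 (_ , 0≉x) = 0≉x ∘ sym

  +-mono-≤ : ∀ {a b c d} → a ≤ b → c ≤ d → a + c ≤ b + d
  +-mono-≤ {a} {b} {c} {d} a≤b c≤d = ≤-trans (+-monoˡ-≤ c a≤b)
    (≤-respˡ (+-comm c b) (≤-respʳ (+-comm d b) (+-monoˡ-≤ b c≤d)))

  x≤y⇒0≤y-x : ∀ {x y} → x ≤ y → 0# ≤ y - x
  x≤y⇒0≤y-x {x} x≤y = ≤-respˡ (-‿inverseʳ x) (+-monoˡ-≤ (- x) x≤y)

  0≤y-x⇒x≤y : ∀ {x y} → 0# ≤ y - x → x ≤ y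
  0≤y-x⇒x≤y {x} {y} 0≤y-x = ≤-respˡ (+-identityˡ x)
    (≤-respʳ (solve 2 (λ x y → (y :- x) :+ x := y) refl x y) (+-monoˡ-≤ x 0≤y-x))

  -- The form in which most inequalities below are proved: the ring solver rewrites the difference
  -- as an expression whose sign is evident.
  ≤-by : ∀ {x y e} → y - x ≈ e → 0# ≤ e → x ≤ y
  ≤-by eq 0≤e = 0≤y-x⇒x≤y (≤-respʳ (sym eq) 0≤e)

  x-y≈0⇒x≈y : ∀ {x y} → x - y ≈ 0# → x ≈ y
  x-y≈0⇒x≈y {x} {y} = RingProperties.x∙y⁻¹≈ε⇒x≈y ring x y

  x≈y⇒x-y≈0 : ∀ {x y} → x ≈ y → x - y ≈ 0#
  x≈y⇒x-y≈0 = RingProperties.x≈y⇒x∙y⁻¹≈ε ring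

  x<y⇒0<y-x : ∀ {x y} → x < y → 0# < y - x
  x<y⇒0<y-x (x≤y , x≉y) = x≤y⇒0≤y-x x≤y , λ 0≈y-x → x≉y (sym (x-y≈0⇒x≈y (sym 0≈y-x)))

  0<y-x⇒x<y : ∀ {x y} → 0# < y - x → x < y
  0<y-x⇒x<y (0≤y-x , 0≉y-x) = 0≤y-x⇒x≤y 0≤y-x , λ x≈y → 0≉y-x (sym (x≈y⇒x-y≈0 (sym x≈y)))

  <-by : ∀ {x y e} → y - x ≈ e → 0# < e → x < y
  <-by eq 0<e = 0<y-x⇒x<y (<-respʳ (sym eq) 0<e)

  +-nonneg : ∀ {x y} → 0# ≤ x → 0# ≤ y → 0# ≤ x + y
  +-nonneg 0≤x 0≤y = ≤-respˡ (+-identityˡ 0#) (+-mono-≤ 0≤x 0≤y)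

  +-pos-nonneg : ∀ {x y} → 0# < x → 0# ≤ y → 0# < x + y
  +-pos-nonneg {x} {y} 0<x 0≤y =
    <-≤-trans 0<x (≤-by (solve 2 (λ x y → (x :+ y) :- x := y) refl x y) 0≤y)

  +-nonneg-pos : ∀ {x y} → 0# ≤ x → 0# < y → 0# < x + y
  +-nonneg-pos 0≤x 0<y = <-respʳ (+-comm _ _) (+-pos-nonneg 0<y 0≤x)

  +-nonneg-zero : ∀ {x y} → 0# ≤ x → 0# ≤ y → x + y ≈ 0# → x ≈ 0# × y ≈ 0#
  +-nonneg-zero {x} {y} 0≤x 0≤y x+y≈0 =
    antisym (≤-respʳ x+y≈0 (≤-by (solve 2 (λ x y → (x :+ y) :- x := y) refl x y) 0≤y)) 0≤x ,
    antisym (≤-respʳ x+y≈0 (≤-by (solve 2 (λ x y → (x :+ y) :- y := x) refl x y) 0≤x)) 0≤y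

  x≤0⇒0≤-x : ∀ {x} → x ≤ 0# → 0# ≤ - x
  x≤0⇒0≤-x x≤0 = ≤-respʳ (+-identityˡ _) (x≤y⇒0≤y-x x≤0)

  *-inverseʳ : ∀ x → ¬ x ≈ 0# → x * x ⁻¹ ≈ 1#
  *-inverseʳ x x≉0 = trans (*-comm _ _) (*-inverseˡ x x≉0)

  *-cancelˡ-≈0 : ∀ {x y} → ¬ x ≈ 0# → x * y ≈ 0# → y ≈ 0#
  *-cancelˡ-≈0 {x} {y} x≉0 xy≈0 = begin
    y               ≈⟨ *-identityˡ y ⟨
    1# * y          ≈⟨ *-congʳ (*-inverseˡ x x≉0) ⟨
    (x ⁻¹ * x) * y  ≈⟨ *-assoc _ _ _ ⟩
    x ⁻¹ * (x * y)  ≈⟨ *-congˡ xy≈0 ⟩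
    x ⁻¹ * 0#       ≈⟨ zeroʳ _ ⟩
    0#              ∎

  *-pos : ∀ {x y} → 0# < x → 0# < y → 0# < x * y
  *-pos 0<x 0<y = *-nonneg (<⇒≤ 0<x) (<⇒≤ 0<y) ,
    λ 0≈xy → pos⇒≉0 0<y (*-cancelˡ-≈0 (pos⇒≉0 0<x) (sym 0≈xy))

  square-nonneg : ∀ x → 0# ≤ x * x
  square-nonneg x with total 0# x
  ... | inj₁ 0≤x = *-nonneg 0≤x 0≤x
  ... | inj₂ x≤0 = ≤-respʳ (solve 1 (λ x → :- x :* :- x := x :* x) refl x)
    (*-nonneg (x≤0⇒0≤-x x≤0) (x≤0⇒0≤-x x≤0))

  0<1 : 0# < 1#
  0<1 = ≤-respʳ (*-identityˡ 1#) (square-nonneg 1#) , 0≉1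

  0<2 : 0# < 2#
  0<2 = +-pos-nonneg 0<1 (<⇒≤ 0<1)

  *-cancelˡ-pos : ∀ {x y} → 0# ≤ x → 0# < x * y → 0# < y
  *-cancelˡ-pos {x} {y} 0≤x 0<xy = ≰⇒> λ y≤0 → <⇒≱ 0<xy (≤-by
    (solve 2 (λ x y → con (+ 0) :- x :* y := x :* :- y) refl x y)
    (*-nonneg 0≤x (x≤0⇒0≤-x y≤0)))

  *-cancelˡ-nonneg : ∀ {x y} → 0# < x → 0# ≤ x * y → 0# ≤ y
  *-cancelˡ-nonneg {x} {y} 0<x 0≤xy with total 0# y
  ... | inj₁ 0≤y = 0≤y
  ... | inj₂ y≤0 = ≤-reflexive (sym (*-cancelˡ-≈0 (pos⇒≉0 0<x) (antisym (≤-by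
    (solve 2 (λ x y → con (+ 0) :- x :* y := x :* :- y) refl x y)
    (*-nonneg (<⇒≤ 0<x) (x≤0⇒0≤-x y≤0))) 0≤xy)))

  square-zero : ∀ {x} → x * x ≈ 0# → x ≈ 0#
  square-zero {x} xx≈0 with em {P = x ≈ 0#}
  ... | yes x≈0 = x≈0
  ... | no  x≉0 = *-cancelˡ-≈0 x≉0 xx≈0

  ⁻¹-pos : ∀ {x} → 0# < x → 0# < x ⁻¹
  ⁻¹-pos {x} 0<x = *-cancelˡ-pos (<⇒≤ 0<x) (<-respʳ (sym (*-inverseʳ x (pos⇒≉0 0<x))) 0<1)

  √-cancel-≤ : ∀ {x y} → 0# ≤ x → 0# ≤ y → √ x ≤ √ y → x ≤ y
  √-cancel-≤ {x} {y} 0≤x 0≤y √x≤√y = ≤-by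
    (begin
      y - x                            ≈⟨ +-cong (√-square 0≤y) (-‿cong (√-square 0≤x)) ⟨
      √ y * √ y - √ x * √ x
        ≈⟨ solve 2 (λ a b → b :* b :- a :* a := (b :+ a) :* (b :- a)) refl (√ x) (√ y) ⟩
      (√ y + √ x) * (√ y - √ x)        ∎)
    (*-nonneg (+-nonneg (√-nonneg 0≤y) (√-nonneg 0≤x)) (x≤y⇒0≤y-x √x≤√y))

  -- If √ y < √ x, then -(√ y - √ x)² = (y - x) + 2 √ y (√ x - √ y) is nonnegative, so the roots
  -- agree after all. The axioms do not state that `√_` respects `_≈_`; two uses of this lemma give
  -- it for nonnegative arguments.
  √-mono-≤ : ∀ {x y} → 0# ≤ x → 0# ≤ y → x ≤ y → √ x ≤ √ y
  √-mono-≤ {x} {y} 0≤x 0≤y x≤y with em {P = √ x ≤ √ y}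
  ... | yes √x≤√y = √x≤√y
  ... | no  √x≰√y = contradiction (antisym √y≤√x (≤-by refl (≤-reflexive (sym √x-√y≈0)))) (proj₂ √y<√x)
    where
    √y<√x = ≰⇒> √x≰√y
    √y≤√x = <⇒≤ √y<√x
    √x-√y≈0 : √ y - √ x ≈ 0#
    √x-√y≈0 = square-zero (antisym (≤-by (begin
      0# - (√ y - √ x) * (√ y - √ x)
        ≈⟨ solve 2 (λ a b → con (+ 0) :- (b :- a) :* (b :- a) :=
             (b :* b :- a :* a) :+ con (+ 2) :* (b :* (a :- b))) refl (√ x) (√ y) ⟩
      (√ y * √ y - √ x * √ x) + 2# * (√ y * (√ x - √ y))
        ≈⟨ +-congʳ (+-cong (√-square 0≤y) (-‿cong (√-square 0≤x))) ⟩
      (y - x) + 2# * (√ y * (√ x - √ y)) ∎)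
      (+-nonneg (x≤y⇒0≤y-x x≤y) (*-nonneg (<⇒≤ 0<2) (*-nonneg (√-nonneg 0≤y) (x≤y⇒0≤y-x √y≤√x)))))
      (square-nonneg _))

  sum-nonneg : ∀ {m} {f : Vector Carrier m} → (∀ i → 0# ≤ f i) → 0# ≤ sum f
  sum-nonneg {zero}  0≤f = ≤-refl
  sum-nonneg {suc m} 0≤f = +-nonneg (0≤f zero) (sum-nonneg (0≤f ∘ suc))

  sum-zero : ∀ {m} {f : Vector Carrier m} → (∀ i → f i ≈ 0#) → sum f ≈ 0#
  sum-zero {zero}  f≈0 = refl
  sum-zero {suc m} f≈0 = trans (+-cong (f≈0 zero) (sum-zero (f≈0 ∘ suc))) (+-identityˡ 0#)

  summand≤sum : ∀ {m} {f : Vector Carrier m} → (∀ i → 0# ≤ f i) → ∀ i → f i ≤ sum f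
  summand≤sum {f = f} 0≤f zero    = ≤-by (solve 2 (λ a b → (a :+ b) :- a :=
       b) refl _ _) (sum-nonneg (0≤f ∘ suc))
  summand≤sum {f = f} 0≤f (suc i) = ≤-by (solve 3 (λ a b c → (a :+ b) :- c := a :+ (b :- c)) refl _ _ _)
    (+-nonneg (0≤f zero) (x≤y⇒0≤y-x (summand≤sum (0≤f ∘ suc) i)))

  sum-nonneg-zero : ∀ {m} {f : Vector Carrier m} → (∀ i → 0# ≤ f i) → sum f ≈ 0# → ∀ i → f i ≈ 0#
  sum-nonneg-zero 0≤f ∑≈0 i = antisym (≤-respʳ ∑≈0 (summand≤sum 0≤f i)) (0≤f i)

  sum-mono-≤ : ∀ {m} {f g : Vector Carrier m} → (∀ i → f i ≤ g i) → sum f ≤ sum g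
  sum-mono-≤ {zero}  f≤g = ≤-refl
  sum-mono-≤ {suc m} f≤g = +-mono-≤ (f≤g zero) (sum-mono-≤ (f≤g ∘ suc))

  -- Reduces an identity between sums to one between summands, which the ring solver can check.
  -- Callers with only two terms fill the third with coefficient `0#`.
  sum-combination : ∀ {m} (a b c : Carrier) {e f g h : Vector Carrier m} →
    (∀ k → e k ≈ a * f k + b * g k + c * h k) → sum e ≈ a * sum f + b * sum g + c * sum h
  sum-combination a b c {e} {f} {g} {h} eq = begin
    sum e                                                            ≈⟨ sum-cong-≋ eq ⟩
    sum (λ k → a * f k + b * g k + c * h k)
      ≈⟨ ∑-distrib-+ (λ k → a * f k + b * g k) _ ⟩
    sum (λ k → a * f k + b * g k) + sum (λ k → c * h k)
      ≈⟨ +-congʳ (∑-distrib-+ (λ k → a * f k) _) ⟩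
    sum (λ k → a * f k) + sum (λ k → b * g k) + sum (λ k → c * h k)
      ≈⟨ +-cong (+-cong (*-distribˡ-sum a f) (*-distribˡ-sum b g)) (*-distribˡ-sum c h) ⟨
    a * sum f + b * sum g + c * sum h                                ∎

  ≋-reflexive : ∀ {d} {x y : Point d} → x ≡ y → x ≋ y
  ≋-reflexive ≡.refl _ = refl

  infix 5 ⟨_,_⟩
  ⟨_,_⟩ : ∀ {d} → Point d → Point d → Carrier
  ⟨ x , y ⟩ = sum λ k → x k * y k

  ‖-‖²-nonneg : ∀ {d} (x y : Point d) → 0# ≤ ‖ x - y ‖²
  ‖-‖²-nonneg x y = sum-nonneg λ k → square-nonneg (x k - y k)

  ‖-‖²≈0⇒≋ : ∀ {d} {x y : Point d} → ‖ x - y ‖² ≈ 0# → x ≋ y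
  ‖-‖²≈0⇒≋ {x = x} {y} eq k =
    x-y≈0⇒x≈y (square-zero (sum-nonneg-zero (λ k → square-nonneg (x k - y k)) eq k))

  ‖-‖²-pos : ∀ {d} {x y : Point d} → ¬ x ≋ y → 0# < ‖ x - y ‖²
  ‖-‖²-pos {x = x} {y} x≉y = ‖-‖²-nonneg x y , λ 0≈ → x≉y (‖-‖²≈0⇒≋ (sym 0≈))

  ‖-‖²-sym : ∀ {d} (x y : Point d) → ‖ x - y ‖² ≈ ‖ y - x ‖²
  ‖-‖²-sym x y = sum-cong-≋ λ k → solve 2 (λ a b → (a :- b) :* (a :- b) :=
       (b :- a) :* (b :- a)) refl (x k) (y k)

  dist≤⇒‖-‖²≤ : ∀ {d} (q x y : Point d) → dist q x ≤ dist q y → ‖ q - x ‖² ≤ ‖ q - y ‖²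
  dist≤⇒‖-‖²≤ q x y = √-cancel-≤ (‖-‖²-nonneg q x) (‖-‖²-nonneg q y)

  ‖-‖²≤⇒dist≤ : ∀ {d} (q x y : Point d) → ‖ q - x ‖² ≤ ‖ q - y ‖² → dist q x ≤ dist q y
  ‖-‖²≤⇒dist≤ q x y = √-mono-≤ (‖-‖²-nonneg q x) (‖-‖²-nonneg q y)

  cosine-law : ∀ {d} (q x r : Point d) →
    ‖ q - x ‖² ≈ ‖ q - r ‖² + ‖ x - r ‖² - 2# * ⟨ (λ k → q k - r k) , (λ k → x k - r k) ⟩
  cosine-law q x r = trans
    (sum-combination 1# 1# (- 2#) λ k → solve 3
      (λ q x r → (q :- x) :* (q :- x) :=
           con (+ 1) :* ((q :- r) :* (q :- r)) :+ con (+ 1) :* ((x :- r) :* (x :- r))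
        :+ :- (con (+ 2)) :* ((q :- r) :* (x :- r))) refl (q k) (x k) (r k))
    (solve 3 (λ a b c → con (+ 1) :* a :+ con (+ 1) :* b :+ :- (con (+ 2)) :* c :=
         a :+ b :- con (+ 2) :* c) refl _ _ _)

  -- Stewart's theorem. The last term does not involve `x`, so along the segment from `u` to `s`
  -- differences of squared distances to two fixed points are affine in `t`.
  stewart : ∀ {d} (u s x : Point d) t →
    ‖ (λ k → u k + t * (s k - u k)) - x ‖² ≈
    (1# - t) * ‖ u - x ‖² + t * ‖ s - x ‖² + (t * t - t) * ‖ u - s ‖²
  stewart u s x t = sum-combination _ _ _ λ k → solve 4
    (λ u s x t → let q = u :+ t :* (s :- u) in (q :- x) :* (q :- x) :=
      (con (+ 1) :- t) :* ((u :- x) :* (u :- x)) :+ t :* ((s :- x) :* (s :- x))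
          :+ (t :* t :- t) :* ((u :- s) :* (u :- s)))
    refl (u k) (s k) (x k) t

  argmin : ∀ {n} (f : Fin n → Carrier) (P : Pred (Fin n) 0ℓ) → ∃ P →
           ∃[ i ] P i × (∀ j → P j → f i ≤ f j)
  argmin {suc n} f P (i , Pi) with em {P = ∃ (P ∘ suc)}
  argmin {suc n} f P (zero  , P0) | no ∄  = zero , P0 , λ where
    zero    _  → ≤-refl
    (suc j) Pj → contradiction (j , Pj) ∄
  argmin {suc n} f P (suc i , Pi) | no ∄  = contradiction (i , Pi) ∄
  argmin {suc n} f P _ | yes ∃P with argmin (f ∘ suc) (P ∘ suc) ∃P
  ... | i , Pi , min with em {P = P zero × f zero ≤ f (suc i)}
  ...   | yes (P0 , f0≤) = zero , P0 , λ where
    zero    _  → ≤-refl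
    (suc j) Pj → ≤-trans f0≤ (min j Pj)
  ...   | no ¬f0≤ = suc i , Pi , λ where
    zero    P0 → <⇒≤ (≰⇒> λ f0≤ → ¬f0≤ (P0 , f0≤))
    (suc j) Pj → min j Pj

  argmax : ∀ {n} (f : Fin n → Carrier) (P : Pred (Fin n) 0ℓ) → ∃ P →
           ∃[ i ] P i × (∀ j → P j → f j ≤ f i)
  argmax f P ∃P with argmin (-_ ∘ f) P ∃P
  ... | i , Pi , min = i , Pi , λ j Pj → ≤-by (solve 2 (λ a b → a :- b :=
       :- b :- :- a) refl _ _) (x≤y⇒0≤y-x (min j Pj))

  positive-lower-bound : ∀ {n} (f : Fin n → Carrier) (P : Pred (Fin n) 0ℓ) →
    (∀ j → P j → 0# < f j) → ∃[ α ] 0# < α × (∀ j → P j → α ≤ f j)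
  positive-lower-bound f P 0<f with em {P = ∃ P}
  -- For empty `P` any positive number is a bound.
  ... | no ∄   = 1# , 0<1 , λ j Pj → contradiction (j , Pj) ∄
  ... | yes ∃P with argmin f P ∃P
  ...   | i , Pi , min = f i , 0<f i Pi , min

-- Farkas' lemma, convex hulls and extreme points.

module Convexity (em : ExcludedMiddle 0ℓ) (ℝ : RealNumbers) where
  open RealNumbers ℝ hiding (zero)
  open NearestNeighbor ℝ
  open IntegerCoefficients.Solver commutativeRing
  open SemiringSum semiring using (sum-cong-≋; ∑-comm; *-distribˡ-sum; *-distribʳ-sum)
  open SetoidReasoning setoid
  open OrderedField em ℝ

  sum-single : ∀ {m} {f : Vector Carrier m} j → (∀ i → i ≢ j → f i ≈ 0#) → sum f ≈ f j
  sum-single zero    f≈0 = trans (+-congˡ (sum-zero λ i → f≈0 (suc i) λ ())) (+-identityʳ _)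
  sum-single (suc j) f≈0 = trans (+-cong (f≈0 zero λ ()) (sum-single j λ i i≢j → f≈0 (suc i) (i≢j ∘ suc-injective)))
    (+-identityˡ _)

  ⟨⟩-congʳ : ∀ {d} (x : Point d) {y z : Point d} → y ≋ z → ⟨ x , y ⟩ ≈ ⟨ x , z ⟩
  ⟨⟩-congʳ x y≋z = sum-cong-≋ λ k → *-congˡ (y≋z k)

  ⟨⟩-linearˡ : ∀ {d} (x y v : Point d) t → ⟨ (λ k → x k - t * y k) , v ⟩ ≈ ⟨ x , v ⟩ - t * ⟨ y , v ⟩
  ⟨⟩-linearˡ x y v t = trans
    (sum-combination 1# (- t) 0# {h = λ k → x k * v k} λ k → solve 4 (λ x y v t → (x :- t :* y) :* v :=
      con (+ 1) :* (x :* v) :+ :- t :* (y :* v) :+ con (+ 0) :* (x :* v)) refl (x k) (y k) (v k) t)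
    (solve 3 (λ a b t → con (+ 1) :* a :+ :- t :* b :+ con (+ 0) :* a := a :- t :* b) refl _ _ t)

  ⟨⟩-comm : ∀ {d} (x y : Point d) → ⟨ x , y ⟩ ≈ ⟨ y , x ⟩
  ⟨⟩-comm x y = sum-cong-≋ λ k → *-comm (x k) (y k)

  ⟨⟩-linearʳ : ∀ {d} (x v w : Point d) t → ⟨ x , (λ k → v k - t * w k) ⟩ ≈ ⟨ x , v ⟩ - t * ⟨ x , w ⟩
  ⟨⟩-linearʳ x v w t = begin
    ⟨ x , (λ k → v k - t * w k) ⟩  ≈⟨ ⟨⟩-comm x _ ⟩
    ⟨ (λ k → v k - t * w k) , x ⟩  ≈⟨ ⟨⟩-linearˡ v w x t ⟩
    ⟨ v , x ⟩ - t * ⟨ w , x ⟩      ≈⟨ +-cong (⟨⟩-comm v x) (-‿cong (*-congˡ (⟨⟩-comm w x))) ⟩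
    ⟨ x , v ⟩ - t * ⟨ x , w ⟩      ∎

  ⟨⟩-sum : ∀ {d m} (x : Point d) (w : Vector Carrier m) (p : Vector (Point d) m) →
    ⟨ x , (λ k → sum λ j → w j * p j k) ⟩ ≈ sum λ j → w j * ⟨ x , p j ⟩
  ⟨⟩-sum x w p = begin
    (sum λ k → x k * sum λ j → w j * p j k)    ≈⟨ (sum-cong-≋ λ k → *-distribˡ-sum (x k) (λ j → w j * p j k)) ⟩
    (sum λ k → sum λ j → x k * (w j * p j k))  ≈⟨ ∑-comm (λ k j → x k * (w j * p j k)) ⟩
    (sum λ j → sum λ k → x k * (w j * p j k))
      ≈⟨ (sum-cong-≋ λ j → sum-cong-≋ λ k → solve 3 (λ x w p → x :* (w :* p) :=
           w :* (x :* p)) refl (x k) (w j) (p j k)) ⟩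
    (sum λ j → sum λ k → w j * (x k * p j k))  ≈⟨ (sum-cong-≋ λ j → *-distribˡ-sum (w j) (λ k → x k * p j k)) ⟨
    (sum λ j → w j * ⟨ x , p j ⟩)              ∎

  ⟨x,x⟩-pos : ∀ {d} (x : Point d) → ¬ (∀ k → x k ≈ 0#) → 0# < ⟨ x , x ⟩
  ⟨x,x⟩-pos x x≉0 = sum-nonneg (λ k → square-nonneg (x k)) ,
    λ 0≈ → x≉0 λ k → square-zero (sum-nonneg-zero (λ k → square-nonneg (x k)) (sym 0≈) k)

  -- Induction on the number of vectors after Bartl: when the functional x found for
  -- the tail fails at α zero, project along α zero onto the kernel of x.
  farkas : ∀ {d m} (α : Vector (Point d) m) (γ : Point d) →
    (Σ[ w ∈ Vector Carrier m ] (∀ j → 0# ≤ w j) × γ ≋ (λ k → sum λ j → w j * α j k)) ⊎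
    (Σ[ x ∈ Point d ] (∀ j → ⟨ x , α j ⟩ ≤ 0#) × 0# < ⟨ x , γ ⟩)
  farkas {m = zero} α γ with em {P = ∀ k → γ k ≈ 0#}
  ... | yes γ≈0 = inj₁ ((λ ()) , (λ ()) , γ≈0)
  ... | no  γ≉0 = inj₂ (γ , (λ ()) , ⟨x,x⟩-pos γ γ≉0)
  farkas {d} {suc m} α γ with farkas (α ∘ suc) γ
  ... | inj₁ (w , 0≤w , γ≋) = inj₁ (0# ∷ w , (λ { zero → ≤-refl ; (suc j) → 0≤w j }) ,
    λ k → trans (γ≋ k) (solve 2 (λ a s → s := con (+ 0) :* a :+ s) refl (α zero k) _))
  ... | inj₂ (x , xα≤0 , 0<xγ) with em {P = ⟨ x , α zero ⟩ ≤ 0#}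
  ...   | yes xα₀≤0 = inj₂ (x , (λ { zero → xα₀≤0 ; (suc j) → xα≤0 j }) , 0<xγ)
  ...   | no  xα₀≰0 = result (farkas (π ∘ α ∘ suc) (π γ))
    where
    P = ⟨ x , α zero ⟩
    0<P : 0# < P
    0<P = ≰⇒> xα₀≰0
    0<P⁻¹ = ⁻¹-pos 0<P
    coeff : Point d → Carrier
    coeff v = ⟨ x , v ⟩ * P ⁻¹
    π : Point d → Point d
    π v k = v k - coeff v * α zero k

    result : _ → _
    result (inj₁ (w , 0≤w , πγ≋)) = inj₁
      -- Undoing the projection collects these multiples of `α zero`. All are nonnegative: `x` is
      -- positive on `γ` and on `α zero`, and nonpositive on the tail.
      ((coeff γ + sum (λ j → w j * - coeff (α (suc j)))) ∷ w ,
       (λ where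
         zero    → +-nonneg (*-nonneg (<⇒≤ 0<xγ) (<⇒≤ 0<P⁻¹)) (sum-nonneg λ j → *-nonneg (0≤w j)
           (≤-respʳ (solve 2 (λ a b → :- a :* b :=
                :- (a :* b)) refl _ _) (*-nonneg (x≤0⇒0≤-x (xα≤0 j)) (<⇒≤ 0<P⁻¹))))
         (suc j) → 0≤w j) ,
       λ k → let S = sum λ j → w j * - coeff (α (suc j)) in begin
         γ k
           ≈⟨ solve 2 (λ g c → g := (g :- c) :+ c) refl (γ k) (coeff γ * α zero k) ⟩
         (γ k - coeff γ * α zero k) + coeff γ * α zero k
           ≈⟨ +-congʳ (πγ≋ k) ⟩
         (sum λ j → w j * (α (suc j) k - coeff (α (suc j)) * α zero k)) + coeff γ * α zero k
           ≈⟨ +-congʳ (sum-combination 1# (α zero k) 0# λ j → solve 4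
                (λ w a c z → w :* (a :- c :* z) := con (+ 1) :* (w :* a) :+ z :* (w :* :- c) :+ con (+ 0) :* w)
                refl (w j) (α (suc j) k) (coeff (α (suc j))) (α zero k)) ⟩
         (1# * (sum λ j → w j * α (suc j) k) + α zero k * S + 0# * sum w) + coeff γ * α zero k
           ≈⟨ solve 5 (λ s t z v c → (con (+ 1) :* s :+ z :* t :+ con (+ 0) :* v) :+ c :* z :=
                (c :+ t) :* z :+ s)
                refl _ S (α zero k) (sum w) (coeff γ) ⟩
         (coeff γ + S) * α zero k + (sum λ j → w j * α (suc j) k) ∎)
    result (inj₂ (y , yπα≤0 , 0<yπγ)) = inj₂
      (x′ ,
       (λ where
         zero    → ≤-reflexive (begin
           ⟨ x′ , α zero ⟩                  ≈⟨ ⟨⟩-linearˡ y x (α zero) _ ⟩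
           ⟨ y , α zero ⟩ - ⟨ y , α zero ⟩ * P ⁻¹ * P
             ≈⟨ solve 3 (λ a i p → a :- a :* i :* p :=
                  a :* (con (+ 1) :- i :* p)) refl ⟨ y , α zero ⟩ (P ⁻¹) P ⟩
           ⟨ y , α zero ⟩ * (1# - P ⁻¹ * P)  ≈⟨ *-congˡ (x≈y⇒x-y≈0 (sym (*-inverseˡ P (pos⇒≉0 0<P)))) ⟩
           ⟨ y , α zero ⟩ * 0#               ≈⟨ zeroʳ _ ⟩
           0#                                ∎)
         (suc j) → ≤-respˡ (sym (x′≈yπ (α (suc j)))) (yπα≤0 j)) ,
       <-respʳ (sym (x′≈yπ γ)) 0<yπγ)
      where
      -- The transpose of `π` applied to `y`; it vanishes on `α zero` because `π` does.
      x′ : Point d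
      x′ k = y k - ⟨ y , α zero ⟩ * P ⁻¹ * x k
      x′≈yπ : ∀ v → ⟨ x′ , v ⟩ ≈ ⟨ y , π v ⟩
      x′≈yπ v = begin
        ⟨ x′ , v ⟩                                       ≈⟨ ⟨⟩-linearˡ y x v _ ⟩
        ⟨ y , v ⟩ - ⟨ y , α zero ⟩ * P ⁻¹ * ⟨ x , v ⟩
          ≈⟨ solve 4 (λ a b i c → a :- b :* i :* c := a :- c :* i :* b) refl _ _ _ _ ⟩
        ⟨ y , v ⟩ - coeff v * ⟨ y , α zero ⟩             ≈⟨ ⟨⟩-linearʳ y v (α zero) _ ⟨
        ⟨ y , π v ⟩                                      ∎

  -- The bound is asked only where the weight is nonzero, so that it can be applied to a second
  -- functional that is bounded merely on the face where a first one is maximal.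
  module _ {m : ℕ} {w v : Vector Carrier m} {V : Carrier} (0≤w : ∀ j → 0# ≤ w j) (∑w≈1 : sum w ≈ 1#)
           (v≤V : ∀ j → ¬ w j ≈ 0# → v j ≤ V) where

    private
      gap : V - sum (λ j → w j * v j) ≈ sum λ j → w j * (V - v j)
      gap = sym (begin
        (sum λ j → w j * (V - v j))
          ≈⟨ sum-combination V (- 1#) 0# (λ j → solve 3 (λ w V v → w :* (V :- v) :=
               V :* w :+ :- con (+ 1) :* (w :* v) :+ con (+ 0) :* w) refl (w j) V (v j)) ⟩
        V * sum w + - 1# * sum (λ j → w j * v j) + 0# * sum w
          ≈⟨ +-cong (+-congʳ (*-congˡ ∑w≈1)) refl ⟩
        V * 1# + - 1# * sum (λ j → w j * v j) + 0# * sum w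
          ≈⟨ solve 3 (λ V s w → V :* con (+ 1) :+ :- con (+ 1) :* s :+ con (+ 0) :* w :=
               V :- s) refl V _ (sum w) ⟩
        V - sum (λ j → w j * v j) ∎)

      gap-nonneg : ∀ j → 0# ≤ w j * (V - v j)
      gap-nonneg j with em {P = w j ≈ 0#}
      ... | yes w≈0 = ≤-reflexive (sym (trans (*-congʳ w≈0) (zeroˡ _)))
      ... | no  w≉0 = *-nonneg (0≤w j) (x≤y⇒0≤y-x (v≤V j w≉0))

    average≤ : sum (λ j → w j * v j) ≤ V
    average≤ = ≤-by gap (sum-nonneg gap-nonneg)

    average≈ : sum (λ j → w j * v j) ≈ V → ∀ j → ¬ w j ≈ 0# → v j ≈ V
    average≈ eq j w≉0 = sym (x-y≈0⇒x≈y (*-cancelˡ-≈0 w≉0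
      (sum-nonneg-zero gap-nonneg (trans (sym gap) (x≈y⇒x-y≈0 (sym eq))) j)))

  convex-max : ∀ {t A B V} → 0# < t → t < 1# → A ≤ V → B ≤ V → V ≈ (1# - t) * A + t * B → A ≈ V × B ≈ V
  convex-max {t} {A} {B} {V} 0<t t<1 A≤V B≤V V≈ =
    tight 0<1-t (proj₁ both≈0) , tight 0<t (proj₂ both≈0)
    where
    0<1-t = x<y⇒0<y-x t<1
    tight : ∀ {c x} → 0# < c → c * (V - x) ≈ 0# → x ≈ V
    tight 0<c eq = sym (x-y≈0⇒x≈y (*-cancelˡ-≈0 (pos⇒≉0 0<c) eq))
    both≈0 = +-nonneg-zero (*-nonneg (<⇒≤ 0<1-t) (x≤y⇒0≤y-x A≤V)) (*-nonneg (<⇒≤ 0<t) (x≤y⇒0≤y-x B≤V)) (begin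
      (1# - t) * (V - A) + t * (V - B)
        ≈⟨ solve 4 (λ t V A B → (con (+ 1) :- t) :* (V :- A) :+ t :* (V :- B) :=
             V :- ((con (+ 1) :- t) :* A :+ t :* B)) refl t V A B ⟩
      V - ((1# - t) * A + t * B)        ≈⟨ x≈y⇒x-y≈0 V≈ ⟩
      0#                                ∎)

  ⟨⟩-segment : ∀ {d} (x a b : Point d) t →
    ⟨ x , (λ k → (1# - t) * a k + t * b k) ⟩ ≈ (1# - t) * ⟨ x , a ⟩ + t * ⟨ x , b ⟩
  ⟨⟩-segment x a b t = trans
    (sum-combination (1# - t) t 0# {h = x} λ k → solve 4 (λ x a b t → x :* ((con (+ 1) :- t) :* a :+ t :* b) :=
      (con (+ 1) :- t) :* (x :* a) :+ t :* (x :* b) :+ con (+ 0) :* x) refl (x k) (a k) (b k) t)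
    (solve 4 (λ a b c t → (con (+ 1) :- t) :* a :+ t :* b :+ con (+ 0) :* c :=
      (con (+ 1) :- t) :* a :+ t :* b) refl _ _ (sum x) t)

  module _ {d : ℕ} {S : Pred (Point d) 0ℓ} where

    -- If `y` lies strictly between `a` and `b` in the hull, maximality forces `φ` to agree at all
    -- three; the weights of `a` and `b` then sit on the maximal face of `φ`, where the same
    -- argument applies to `ψ`. Uniqueness leaves only `y` to carry weight.
    lexicographic-max⇒Extreme : ∀ {y} (φ ψ : Point d) → y ∈ S →
      (∀ {p} → p ∈ S → ⟨ φ , p ⟩ ≤ ⟨ φ , y ⟩) →
      (∀ {p} → p ∈ S → ⟨ φ , p ⟩ ≈ ⟨ φ , y ⟩ → ⟨ ψ , p ⟩ ≤ ⟨ ψ , y ⟩) →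
      (∀ {p} → p ∈ S → ⟨ φ , p ⟩ ≈ ⟨ φ , y ⟩ → ⟨ ψ , p ⟩ ≈ ⟨ ψ , y ⟩ → p ≋ y) →
      Extreme S y
    lexicographic-max⇒Extreme {y} φ ψ y∈S φ-max ψ-max unique =
      (1 , (λ _ → y) , (λ _ → 1#) , (λ _ → y∈S) , (λ _ → <⇒≤ 0<1) , +-identityʳ 1# ,
        λ k → solve 1 (λ y → y := con (+ 1) :* y :+ con (+ 0)) refl (y k)) ,
      λ a b t a∈ b∈ 0<t t<1 y≋ →
        let φ≈ = convex-max 0<t t<1 (hull-φ≤ a∈) (hull-φ≤ b∈) (trans (⟨⟩-congʳ φ y≋) (⟨⟩-segment φ a b t))
            ψ≈ = convex-max 0<t t<1 (hull-ψ≤ a∈ (proj₁ φ≈)) (hull-ψ≤ b∈ (proj₂ φ≈))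
                   (trans (⟨⟩-congʳ ψ y≋) (⟨⟩-segment ψ a b t))
            a≋y = hull-unique a∈ (proj₁ φ≈) (proj₁ ψ≈)
            b≋y = hull-unique b∈ (proj₂ φ≈) (proj₂ ψ≈)
        in λ k → trans (a≋y k) (sym (b≋y k))
      where
      hull-φ≤ : ∀ {a} → a ∈ ConvexHull S → ⟨ φ , a ⟩ ≤ ⟨ φ , y ⟩
      hull-φ≤ (m , p , w , p∈S , 0≤w , ∑w≈1 , a≋) =
        ≤-respˡ (sym (trans (⟨⟩-congʳ φ a≋) (⟨⟩-sum φ w p))) (average≤ 0≤w ∑w≈1 λ j _ → φ-max (p∈S j))

      φ-tight : ∀ {a} ((m , p , w , _) : a ∈ ConvexHull S) → ⟨ φ , a ⟩ ≈ ⟨ φ , y ⟩ →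
                ∀ j → ¬ w j ≈ 0# → ⟨ φ , p j ⟩ ≈ ⟨ φ , y ⟩
      φ-tight (m , p , w , p∈S , 0≤w , ∑w≈1 , a≋) φ≈ =
        average≈ 0≤w ∑w≈1 (λ j _ → φ-max (p∈S j)) (trans (sym (trans (⟨⟩-congʳ φ a≋) (⟨⟩-sum φ w p))) φ≈)

      hull-ψ≤ : ∀ {a} → a ∈ ConvexHull S → ⟨ φ , a ⟩ ≈ ⟨ φ , y ⟩ → ⟨ ψ , a ⟩ ≤ ⟨ ψ , y ⟩
      hull-ψ≤ a∈@(m , p , w , p∈S , 0≤w , ∑w≈1 , a≋) φ≈ =
        ≤-respˡ (sym (trans (⟨⟩-congʳ ψ a≋) (⟨⟩-sum ψ w p)))
          (average≤ 0≤w ∑w≈1 λ j w≉0 → ψ-max (p∈S j) (φ-tight a∈ φ≈ j w≉0))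

      hull-unique : ∀ {a} → a ∈ ConvexHull S → ⟨ φ , a ⟩ ≈ ⟨ φ , y ⟩ → ⟨ ψ , a ⟩ ≈ ⟨ ψ , y ⟩ → a ≋ y
      hull-unique {a} a∈@(m , p , w , p∈S , 0≤w , ∑w≈1 , a≋) φ≈ ψ≈ k = begin
        a k                      ≈⟨ a≋ k ⟩
        (sum λ j → w j * p j k)  ≈⟨ sum-cong-≋ wp≈wy ⟩
        (sum λ j → w j * y k)    ≈⟨ *-distribʳ-sum (y k) w ⟨
        sum w * y k              ≈⟨ *-congʳ ∑w≈1 ⟩
        1# * y k                 ≈⟨ *-identityˡ _ ⟩
        y k                      ∎
        where
        ψ-tight = average≈ 0≤w ∑w≈1 (λ j w≉0 → ψ-max (p∈S j) (φ-tight a∈ φ≈ j w≉0))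
          (trans (sym (trans (⟨⟩-congʳ ψ a≋) (⟨⟩-sum ψ w p))) ψ≈)
        wp≈wy : ∀ j → w j * p j k ≈ w j * y k
        wp≈wy j with em {P = w j ≈ 0#}
        ... | yes w≈0 = trans (*-congʳ w≈0) (trans (zeroˡ _) (sym (trans (*-congʳ w≈0) (zeroˡ _))))
        ... | no  w≉0 = *-congˡ (unique (p∈S j) (φ-tight a∈ φ≈ j w≉0) (ψ-tight j w≉0) k)

    -- Take `p j` of nonzero weight `l` and prolong the segment from `p j` through `y` by the factor
    -- `l` to `b`. If `b` is in the hull, `y` is strictly between `b` and `p j`, so extremality
    -- collapses the segment. Averaging the remaining points instead would require dividing by 1 -
    -- l, which may vanish; 1 + l cannot.
    Extreme⇒combination-trivial : ∀ {y m} → Extreme S y → (p : Vector (Point d) m) (w : Vector Carrier m) →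
      (∀ j → p j ∈ S) → (∀ j → 0# ≤ w j) → sum w ≈ 1# → y ≋ (λ k → sum λ j → w j * p j k) →
      ∃[ j ] p j ≋ y
    Extreme⇒combination-trivial {y} {m} (_ , extreme) p w p∈S 0≤w ∑w≈1 y≋ with em {P = ∃[ j ] ¬ w j ≈ 0#}
    ... | no  ∄ = contradiction (trans (sym (sum-zero w≈0)) ∑w≈1) 0≉1
      where
      w≈0 : ∀ j → w j ≈ 0#
      w≈0 j with em {P = w j ≈ 0#}
      ... | yes w≈0 = w≈0
      ... | no  w≉0 = contradiction (j , w≉0) ∄
    ... | yes (j , w≉0) = j , λ k → sym (x-y≈0⇒x≈y (*-cancelˡ-≈0 (pos⇒≉0 0<1+l) (begin
        (1# + l) * (y k - p j k)
          ≈⟨ solve 3 (λ l y p → (con (+ 1) :+ l) :* (y :- p) := y :+ l :* (y :- p) :- p) refl l (y k) (p j k) ⟩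
        (y k + l * (y k - p j k)) - p j k   ≈⟨ x≈y⇒x-y≈0 (b≋p k) ⟩
        0#                                  ∎)))
      where
      l = w j
      0<1+l : 0# < 1# + l
      0<1+l = +-pos-nonneg 0<1 (0≤w j)
      σ = (1# + l) ⁻¹
      0<σ = ⁻¹-pos 0<1+l
      σ-inverse : σ * (1# + l) ≈ 1#
      σ-inverse = *-inverseˡ _ (pos⇒≉0 0<1+l)
      b : Point d
      b k = y k + l * (y k - p j k)

      δ : Fin m → Carrier
      δ i = if ⌊ i ≟ j ⌋ then 1# else 0#
      δ-off : ∀ i → i ≢ j → δ i ≈ 0#
      δ-off i i≢j with i ≟ j
      ... | yes i≡j = contradiction i≡j i≢j
      ... | no  _   = refl
      δ-on : δ j ≈ 1#
      δ-on with j ≟ j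
      ... | yes _   = refl
      ... | no  j≢j = contradiction ≡.refl j≢j
      ∑δ : ∀ (f : Fin m → Carrier) → sum (λ i → δ i * f i) ≈ f j
      ∑δ f = trans (sum-single j λ i i≢j → trans (*-congʳ (δ-off i i≢j)) (zeroˡ _))
          (trans (*-congʳ δ-on) (*-identityˡ _))

      -- The weights of `b`. The factor `l` makes the one at `j` equal to (1 + l) l - l = l², hence
      -- nonnegative.
      w′ : Vector Carrier m
      w′ i = (1# + l) * w i - l * δ i
      0≤w′ : ∀ i → 0# ≤ w′ i
      0≤w′ i with i ≟ j
      ... | yes ≡.refl = ≤-respʳ (solve 1 (λ l → l :* l :=
           (con (+ 1) :+ l) :* l :- l :* con (+ 1)) refl l) (square-nonneg l)
      ... | no  _      = ≤-respʳ (solve 2 (λ l w → (con (+ 1) :+ l) :* w :=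
           (con (+ 1) :+ l) :* w :- l :* con (+ 0)) refl l (w i))
                           (*-nonneg (<⇒≤ 0<1+l) (0≤w i))

      ∑w′ : ∀ f → sum (λ i → w′ i * f i) ≈ (1# + l) * sum (λ i → w i * f i) - l * f j
      ∑w′ f = begin
        (sum λ i → w′ i * f i)
          ≈⟨ sum-combination (1# + l) (- l) 0# (λ i → solve 4 (λ l w δ f → ((con (+ 1) :+ l) :* w :- l :* δ) :* f :=
               (con (+ 1) :+ l) :* (w :* f) :+ :- l :* (δ :* f) :+ con (+ 0) :* w) refl l (w i) (δ i) (f i)) ⟩
        (1# + l) * sum (λ i → w i * f i) + - l * sum (λ i → δ i * f i) + 0# * sum w
          ≈⟨ +-congʳ (+-congˡ (*-congˡ (∑δ f))) ⟩
        (1# + l) * sum (λ i → w i * f i) + - l * f j + 0# * sum w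
          ≈⟨ solve 4 (λ l a f s → (con (+ 1) :+ l) :* a :+ :- l :* f :+ con (+ 0) :* s :=
               (con (+ 1) :+ l) :* a :- l :* f)
               refl l _ (f j) (sum w) ⟩
        (1# + l) * sum (λ i → w i * f i) - l * f j ∎

      b∈hull : b ∈ ConvexHull S
      b∈hull = m , p , w′ , p∈S , 0≤w′ ,
        (begin
          sum w′                                   ≈⟨ sum-cong-≋ (λ i → sym (*-identityʳ (w′ i))) ⟩
          (sum λ i → w′ i * 1#)                    ≈⟨ ∑w′ (λ _ → 1#) ⟩
          (1# + l) * sum (λ i → w i * 1#) - l * 1# ≈⟨ +-congʳ (*-congˡ (sum-cong-≋ λ i → *-identityʳ (w i))) ⟩
          (1# + l) * sum w - l * 1#                ≈⟨ +-congʳ (*-congˡ ∑w≈1) ⟩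
          (1# + l) * 1# - l * 1#
            ≈⟨ solve 1 (λ l → (con (+ 1) :+ l) :* con (+ 1) :- l :* con (+ 1) := con (+ 1)) refl l ⟩
          1#                                       ∎) ,
        λ k → begin
          y k + l * (y k - p j k)
            ≈⟨ solve 3 (λ l y p → y :+ l :* (y :- p) := (con (+ 1) :+ l) :* y :- l :* p) refl l (y k) (p j k) ⟩
          (1# + l) * y k - l * p j k                      ≈⟨ +-congʳ (*-congˡ (y≋ k)) ⟩
          (1# + l) * sum (λ i → w i * p i k) - l * p j k  ≈⟨ ∑w′ (λ i → p i k) ⟨
          (sum λ i → w′ i * p i k)                        ∎

      pj∈hull : p j ∈ ConvexHull S
      pj∈hull = 1 , (λ _ → p j) , (λ _ → 1#) , (λ _ → p∈S j) , (λ _ → <⇒≤ 0<1) , +-identityʳ 1# ,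
        λ k → solve 1 (λ y → y := con (+ 1) :* y :+ con (+ 0)) refl (p j k)

      b≋p : b ≋ p j
      b≋p = extreme b (p j) (l * σ) b∈hull pj∈hull
        (*-pos (≤∧≉⇒< (0≤w j) (w≉0 ∘ sym)) 0<σ)
        (<-by (begin
          1# - l * σ               ≈⟨ +-congʳ σ-inverse ⟨
          σ * (1# + l) - l * σ     ≈⟨ solve 2 (λ l σ → σ :* (con (+ 1) :+ l) :- l :* σ := σ) refl l σ ⟩
          σ                        ∎) 0<σ)
        λ k → sym (begin
          (1# - l * σ) * b k + l * σ * p j k
            ≈⟨ solve 4 (λ l σ y p → (con (+ 1) :- l :* σ) :* (y :+ l :* (y :- p)) :+ l :* σ :* p :=
                 (y :+ l :* (y :- p)) :* (con (+ 1) :- σ :* (con (+ 1) :+ l)) :+ σ :* (con (+ 1) :+ l) :* y)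
                     refl l σ (y k) (p j k) ⟩
          b k * (1# - σ * (1# + l)) + σ * (1# + l) * y k
            ≈⟨ +-cong (*-congˡ (x≈y⇒x-y≈0 (sym σ-inverse))) (*-congʳ σ-inverse) ⟩
          b k * 0# + 1# * y k
            ≈⟨ solve 2 (λ b y → b :* con (+ 0) :+ con (+ 1) :* y := y) refl (b k) (y k) ⟩
          y k ∎)

    -- Homogenisation: a leading coordinate `1#` turns conic combinations into convex ones, which
    -- extremality excludes. In the other alternative of Farkas' lemma the leading coordinate of the
    -- functional, negated, is the threshold `h`.
    Extreme⇒separated : ∀ {y m} → Extreme S y → (p : Vector (Point d) m) → (∀ j → p j ∈ S) → (∀ j → ¬ p j ≋ y) →
      (r : Point d) → Σ[ g ∈ Point d ] ∃[ h ] (∀ j → ⟨ g , (λ k → p j k - r k) ⟩ ≤ h) × h < ⟨ g , (λ k → y k - r k) ⟩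
    Extreme⇒separated {y} {m} extreme p p∈S p≉y r
      with farkas (λ j → 1# ∷ λ k → p j k - r k) (1# ∷ λ k → y k - r k)
    ... | inj₁ (w , 0≤w , γ≋) = contradiction (proj₂ trivial) (p≉y (proj₁ trivial))
      where
      ∑w≈1 : sum w ≈ 1#
      ∑w≈1 = trans (sum-cong-≋ λ i → sym (*-identityʳ (w i))) (sym (γ≋ zero))
      trivial = Extreme⇒combination-trivial extreme p w p∈S 0≤w ∑w≈1 λ k → begin
        y k                                           ≈⟨ solve 2 (λ y r → y := (y :- r) :+ r) refl (y k) (r k) ⟩
        (y k - r k) + r k                             ≈⟨ +-congʳ (γ≋ (suc k)) ⟩
        (sum λ j → w j * (p j k - r k)) + r k
          ≈⟨ +-congʳ (sum-combination 1# (- r k) 0# λ j → solve 3 (λ w p r → w :* (p :- r) :=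
               con (+ 1) :* (w :* p) :+ :- r :* w :+ con (+ 0) :* w) refl (w j) (p j k) (r k)) ⟩
        (1# * (sum λ j → w j * p j k) + - r k * sum w + 0# * sum w) + r k
          ≈⟨ solve 3 (λ s r w → (con (+ 1) :* s :+ :- r :* w :+ con (+ 0) :* w) :+ r :=
               s :+ r :* (con (+ 1) :- w)) refl _ (r k) (sum w) ⟩
        (sum λ j → w j * p j k) + r k * (1# - sum w)  ≈⟨ +-congˡ (*-congˡ (x≈y⇒x-y≈0 (sym ∑w≈1))) ⟩
        (sum λ j → w j * p j k) + r k * 0#            ≈⟨ +-congˡ (zeroʳ (r k)) ⟩
        (sum λ j → w j * p j k) + 0#                  ≈⟨ +-identityʳ _ ⟩
        (sum λ j → w j * p j k)                       ∎
    ... | inj₂ (x , xα≤0 , 0<xγ) = x ∘ suc , - x zero ,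
      (λ j → ≤-by (solve 2 (λ a b → :- a :- b :=
           con (+ 0) :- (a :* con (+ 1) :+ b)) refl (x zero) _) (x≤y⇒0≤y-x (xα≤0 j))) ,
      <-by (solve 2 (λ a b → b :- :- a := a :* con (+ 1) :+ b) refl (x zero) _) 0<xγ

-- Inversion, walls and relevance.

module Geometry (em : ExcludedMiddle 0ℓ) (ℝ : RealNumbers) where
  open RealNumbers ℝ hiding (zero; distrib)
  open NearestNeighbor ℝ
  open IntegerCoefficients.Solver commutativeRing
  open SemiringSum semiring using (sum-cong-≋; *-distribˡ-sum)
  open SetoidReasoning setoid
  open OrderedField em ℝ
  open Convexity em ℝ

  infixl 6 _⊝_
  _⊝_ : ∀ {d} → Point d → Point d → Point d
  (x ⊝ y) k = x k - y k

  ⟨⟩-⊝ : ∀ {d} (x v w : Point d) → ⟨ x , v ⊝ w ⟩ ≈ ⟨ x , v ⟩ - ⟨ x , w ⟩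
  ⟨⟩-⊝ x v w = trans
    (sum-combination 1# (- 1#) 0# {h = x} λ k → solve 3 (λ x v w → x :* (v :- w) :=
      con (+ 1) :* (x :* v) :+ :- con (+ 1) :* (x :* w) :+ con (+ 0) :* x) refl (x k) (v k) (w k))
    (solve 3 (λ a b c → con (+ 1) :* a :+ :- con (+ 1) :* b :+ con (+ 0) :* c := a :- b) refl _ _ (sum x))

  polarization : ∀ {d} (x y : Point d) → ‖ x - y ‖² ≈ ⟨ x , x ⟩ + ⟨ y , y ⟩ - 2# * ⟨ y , x ⟩
  polarization x y = trans
    (sum-combination 1# 1# (- 2#) λ k → solve 2 (λ x y → (x :- y) :* (x :- y) :=
      con (+ 1) :* (x :* x) :+ con (+ 1) :* (y :* y) :+ :- con (+ 2) :* (y :* x)) refl (x k) (y k))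
    (solve 3 (λ a b c → con (+ 1) :* a :+ con (+ 1) :* b :+ :- con (+ 2) :* c :=
         a :+ b :- con (+ 2) :* c) refl _ _ _)

  ‖x-x‖²≈0 : ∀ {d} (x : Point d) → ‖ x - x ‖² ≈ 0#
  ‖x-x‖²≈0 x = sum-zero λ k → solve 1 (λ a → (a :- a) :* (a :- a) := con (+ 0)) refl (x k)

  invert-⊝ : ∀ {d} (r x : Point d) k → invert r x k - r k ≈ ‖ x - r ‖² ⁻¹ * (x k - r k)
  invert-⊝ r x k = solve 3 (λ r x i → (r :+ (x :- r) :* i) :- r := i :* (x :- r)) refl (r k) (x k) _

  module _ {d : ℕ} {r : Point d} where

    ‖-‖²-inverse : ∀ {x : Point d} → ¬ x ≋ r → ‖ x - r ‖² * ‖ x - r ‖² ⁻¹ ≈ 1#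
    ‖-‖²-inverse x≉r = *-inverseʳ _ (pos⇒≉0 (‖-‖²-pos x≉r))

    ⟨⟩-invert : ∀ {x : Point d} → ¬ x ≋ r → ∀ v → ‖ x - r ‖² * ⟨ v , invert r x ⊝ r ⟩ ≈ ⟨ v , x ⊝ r ⟩
    ⟨⟩-invert {x} x≉r v = begin
      N * ⟨ v , invert r x ⊝ r ⟩                        ≈⟨ *-distribˡ-sum N (λ k → v k * (invert r x k - r k)) ⟩
      (sum λ k → N * (v k * (invert r x k - r k)))
        ≈⟨ (sum-cong-≋ λ k → *-congˡ (*-congˡ (invert-⊝ r x k))) ⟩
      (sum λ k → N * (v k * (N ⁻¹ * (x k - r k))))
        ≈⟨ (sum-cong-≋ λ k → solve 4 (λ n i v x → n :* (v :* (i :* x)) :=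
             n :* i :* (v :* x)) refl N (N ⁻¹) (v k) (x k - r k)) ⟩
        (sum λ k → N * N ⁻¹ * (v k * (x k - r k)))
          ≈⟨ *-distribˡ-sum (N * N ⁻¹) (λ k → v k * (x k - r k)) ⟨
        N * N ⁻¹ * ⟨ v , x ⊝ r ⟩                          ≈⟨ *-congʳ (‖-‖²-inverse x≉r) ⟩
        1# * ⟨ v , x ⊝ r ⟩                                ≈⟨ *-identityˡ _ ⟩
      ⟨ v , x ⊝ r ⟩                                     ∎
      where N = ‖ x - r ‖²

    -- x is nearer to q than r exactly when the inverse of x lies beyond the
    -- hyperplane 2⟨ q - r , y - r ⟩ = 1.
    ‖-‖²-invert : ∀ {x : Point d} → ¬ x ≋ r → ∀ q →
      ‖ q - x ‖² - ‖ q - r ‖² ≈ ‖ x - r ‖² * (1# - 2# * ⟨ q ⊝ r , invert r x ⊝ r ⟩)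
    ‖-‖²-invert {x} x≉r q = begin
      ‖ q - x ‖² - D                            ≈⟨ +-congʳ (cosine-law q x r) ⟩
      D + N - 2# * ⟨ q ⊝ r , x ⊝ r ⟩ - D
        ≈⟨ +-congʳ (+-congˡ (-‿cong (*-congˡ (⟨⟩-invert x≉r (q ⊝ r))))) ⟨
      D + N - 2# * (N * I) - D
        ≈⟨ solve 3 (λ d n i → d :+ n :- con (+ 2) :* (n :* i) :- d :=
             n :* (con (+ 1) :- con (+ 2) :* i)) refl D N I ⟩
      N * (1# - 2# * I)                         ∎
      where
      D = ‖ q - r ‖²
      N = ‖ x - r ‖²
      I = ⟨ q ⊝ r , invert r x ⊝ r ⟩

    invert≉centre : ∀ {x : Point d} → ¬ x ≋ r → ¬ r ≋ invert r x
    invert≉centre {x} x≉r r≋ = x≉r λ k → x-y≈0⇒x≈y (*-cancelˡ-≈0 (pos⇒≉0 (⁻¹-pos (‖-‖²-pos x≉r)))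
      (trans (sym (invert-⊝ r x k)) (x≈y⇒x-y≈0 (sym (r≋ k)))))

    -- The squared norm of `invert r x ⊝ r` is the scaling factor `‖ x - r ‖² ⁻¹` itself, so equal
    -- images have equal factors, and these cancel.
    invert-injective : ∀ {x z : Point d} → ¬ x ≋ r → ¬ z ≋ r → invert r x ≋ invert r z → x ≋ z
    invert-injective {x} {z} x≉r z≉r eq k = x-y≈0⇒x≈y (*-cancelˡ-≈0 (pos⇒≉0 (⁻¹-pos (‖-‖²-pos x≉r))) (begin
      i * (x k - z k)
        ≈⟨ solve 4 (λ i x z r → i :* (x :- z) := i :* (x :- r) :- i :* (z :- r)) refl i (x k) (z k) (r k) ⟩
      i * (x k - r k) - i * (z k - r k)      ≈⟨ +-congˡ (-‿cong (*-congʳ i≈j)) ⟩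
      i * (x k - r k) - j * (z k - r k)      ≈⟨ x≈y⇒x-y≈0 (ix≈jz k) ⟩
      0#                                     ∎))
      where
      i = ‖ x - r ‖² ⁻¹
      j = ‖ z - r ‖² ⁻¹
      ix≈jz : ∀ k → i * (x k - r k) ≈ j * (z k - r k)
      ix≈jz k = trans (sym (invert-⊝ r x k)) (trans (+-congʳ (eq k)) (invert-⊝ r z k))
      inverse-norm : ∀ {x : Point d} → ¬ x ≋ r → let c = ‖ x - r ‖² ⁻¹ in
        (sum λ k → (c * (x k - r k)) * (c * (x k - r k))) ≈ c
      inverse-norm {x} x≉r = let c = ‖ x - r ‖² ⁻¹ in begin
        (sum λ k → (c * (x k - r k)) * (c * (x k - r k)))
          ≈⟨ (sum-cong-≋ λ k → solve 2 (λ c x → (c :* x) :* (c :* x) :=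
               (c :* c) :* (x :* x)) refl c (x k - r k)) ⟩
        (sum λ k → (c * c) * ((x k - r k) * (x k - r k)))
          ≈⟨ *-distribˡ-sum (c * c) (λ k → (x k - r k) * (x k - r k)) ⟨
        (c * c) * ‖ x - r ‖²           ≈⟨ solve 2 (λ c n → (c :* c) :* n := c :* (n :* c)) refl c ‖ x - r ‖² ⟩
        c * (‖ x - r ‖² * c)           ≈⟨ *-congˡ (‖-‖²-inverse x≉r) ⟩
        c * 1#                         ≈⟨ *-identityʳ c ⟩
        c                              ∎
      i≈j : i ≈ j
      i≈j = trans (sym (inverse-norm x≉r)) (trans (sum-cong-≋ λ k → *-cong (ix≈jz k) (ix≈jz k)) (inverse-norm z≉r))

  module _ {d n : ℕ} {K : Set} (T : TrainingSet d n K) where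
    open TrainingSet T

    D : Point d → Fin n → Carrier
    D q i = ‖ q - point i ‖²

    point-≢ : ∀ {i j} → i ≢ j → ¬ point i ≋ point j
    point-≢ i≢j eq = i≢j (distinct eq)

    Nearest⇒D≤ : ∀ {X q i j} → i ∈ Nearest T X q → j ∈ X → D q i ≤ D q j
    Nearest⇒D≤ {q = q} {i} {j} (_ , min) j∈X = dist≤⇒‖-‖²≤ q (point i) (point j) (min j j∈X)

    D≤⇒Nearest : ∀ {X q i} → i ∈ X → (∀ j → j ∈ X → D q i ≤ D q j) → i ∈ Nearest T X q
    D≤⇒Nearest {q = q} {i} i∈X min = i∈X , λ j j∈X → ‖-‖²≤⇒dist≤ q (point i) (point j) (min j j∈X)

    -- Move the centre from u towards s until the sphere through s has lost all
    -- points of the class of r but the last ones.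
    wall⇒Relevant : ∀ {X r s} u → r ∈ X → s ∈ X → class s ≢ class r → D u r ≤ D u s →
      (∀ x → x ∈ X → class x ≢ class r → x ≢ s → D u s < D u x) → Relevant T X s
    wall⇒Relevant {X} {r} {s} u r∈X s∈X s≢r Dr≤Ds Ds<Dx =
      s∈X , q , class s , class r , (∃nearest-s , nearest-s) , (∃nearest-r , nearest-r) , s≢r
      where
      a b : Fin n → Carrier
      a x = D u x - D u s
      b x = ‖ point s - point x ‖²

      Same Other : Pred (Fin n) 0ℓ
      Same  x = x ∈ X × class x ≡ class r
      Other x = x ∈ X × class x ≢ class r × x ≢ s

      0<b : ∀ {x} → x ≢ s → 0# < b x
      0<b x≢s = ‖-‖²-pos (point-≢ (x≢s ∘ ≡.sym))

      Same⇒≢s : ∀ {x} → Same x → x ≢ s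
      Same⇒≢s (_ , eq) ≡.refl = s≢r eq

      -- At the fraction t of the way to `s`, D(x) - D(s) = (1 - t) a(x) + t b(x), which vanishes
      -- where t / (1 - t) = -a(x) / b(x). The point with the smallest ratio is therefore the last
      -- to leave the sphere.
      last : ∃[ x ] Same x × (∀ y → Same y → a x * b x ⁻¹ ≤ a y * b y ⁻¹)
      last = argmin _ Same (r , r∈X , ≡.refl)
      x₀ = proj₁ last
      x₀-Same = proj₁ (proj₂ last)
      a₀ = a x₀
      b₀ = b x₀
      0<b₀ = 0<b (Same⇒≢s x₀-Same)

      last-ratio : ∀ {x} → Same x → 0# ≤ a x * b₀ - a₀ * b x
      last-ratio {x} x-Same = ≤-respʳ (begin
        (b₀ * b x) * (a x * b x ⁻¹ - a₀ * b₀ ⁻¹)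
          ≈⟨ solve 6 (λ b₀ b a i a₀ j → (b₀ :* b) :* (a :* i :- a₀ :* j) :=
               a :* b₀ :* (b :* i) :- a₀ :* b :* (b₀ :* j))
               refl b₀ (b x) (a x) (b x ⁻¹) a₀ (b₀ ⁻¹) ⟩
        a x * b₀ * (b x * b x ⁻¹) - a₀ * b x * (b₀ * b₀ ⁻¹)
          ≈⟨ +-cong (*-congˡ (*-inverseʳ _ (pos⇒≉0 0<bx))) (-‿cong (*-congˡ (*-inverseʳ _ (pos⇒≉0 0<b₀)))) ⟩
        a x * b₀ * 1# - a₀ * b x * 1#
          ≈⟨ +-cong (*-identityʳ _) (-‿cong (*-identityʳ _)) ⟩
        a x * b₀ - a₀ * b x ∎)
        (*-nonneg (<⇒≤ (*-pos 0<b₀ 0<bx)) (x≤y⇒0≤y-x (proj₂ (proj₂ last) x x-Same)))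
        where 0<bx = 0<b (Same⇒≢s x-Same)

      -- `r` is no farther from `u` than `s`, so its ratio is nonpositive, and that of `x₀` is no
      -- larger.
      0≤-a₀ : 0# ≤ - a₀
      0≤-a₀ = *-cancelˡ-nonneg (0<b (Same⇒≢s (r∈X , ≡.refl))) (≤-respʳ
        (solve 4 (λ ar b₀ a₀ br → (ar :* b₀ :- a₀ :* br) :+ :- ar :* b₀ := br :* :- a₀) refl (a r) b₀ a₀ (b r))
        (+-nonneg (last-ratio (r∈X , ≡.refl)) (*-nonneg (≤-respʳ
          (solve 2 (λ x y → y :- x := :- (x :- y)) refl (D u r) (D u s)) (x≤y⇒0≤y-x Dr≤Ds)) (<⇒≤ 0<b₀))))

      bound = positive-lower-bound a Other λ x (x∈X , x≢r , x≢s) → x<y⇒0<y-x (Ds<Dx x x∈X x≢r x≢s)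
      α = proj₁ bound
      0<α = proj₁ (proj₂ bound)
      0<α-a₀ : 0# < α - a₀
      0<α-a₀ = +-pos-nonneg 0<α 0≤-a₀
      W = α - a₀ + b₀
      0<W : 0# < W
      0<W = +-pos-nonneg 0<α-a₀ (<⇒≤ 0<b₀)
      -- Here t / (1 - t) = (α - a₀) / b₀, beyond the exit of `x₀` by α / b₀. So `x₀` is outside the
      -- sphere by only α b₀ / W, whereas each point of `Other` has a starting lead of at least `α`
      -- and gains more.
      τ = (α - a₀) * W ⁻¹
      Wτ≈ : W * τ ≈ α - a₀
      Wτ≈ = trans (solve 3 (λ w c i → w :* (c :* i) := c :* (w :* i)) refl W (α - a₀) (W ⁻¹))
        (trans (*-congˡ (*-inverseʳ _ (pos⇒≉0 0<W))) (*-identityʳ _))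
      q : Point d
      q k = u k + τ * (point s k - u k)

      gap : ∀ x → W * (D q x - D q s) ≈ b₀ * a x + (α - a₀) * b x
      gap x = begin
        W * (D q x - D q s)
          ≈⟨ *-congˡ (+-cong (stewart u (point s) (point x) τ) (-‿cong (stewart u (point s) (point s) τ))) ⟩
        W * (((1# - τ) * D u x + τ * b x + C) - ((1# - τ) * D u s + τ * b s + C))
          ≈⟨ solve 7 (λ w t x bx c s bs → w :* (((con (+ 1) :- t) :* x :+ t :* bx :+ c)
              :- ((con (+ 1) :- t) :* s :+ t :* bs :+ c)) :=
               (w :- w :* t) :* (x :- s) :+ w :* t :* (bx :- bs)) refl W τ (D u x) (b x) C (D u s) (b s) ⟩
        (W - W * τ) * a x + W * τ * (b x - b s)
          ≈⟨ +-cong (*-congʳ (+-congˡ (-‿cong Wτ≈))) (*-cong Wτ≈ (+-congˡ (-‿cong (‖x-x‖²≈0 (point s))))) ⟩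
        (W - (α - a₀)) * a x + (α - a₀) * (b x - 0#)
          ≈⟨ solve 4 (λ c b₀ a b → ((c :+ b₀) :- c) :* a :+ c :* (b :- con (+ 0)) :=
               b₀ :* a :+ c :* b) refl (α - a₀) b₀ (a x) (b x) ⟩
        b₀ * a x + (α - a₀) * b x ∎
        where C = (τ * τ - τ) * D u (s)

      Same⇒s< : ∀ {x} → Same x → D q s < D q x
      Same⇒s< {x} x-Same = 0<y-x⇒x<y (*-cancelˡ-pos (<⇒≤ 0<W) (<-respʳ (sym (trans (gap x)
        (solve 5 (λ b₀ a α a₀ b → b₀ :* a :+ (α :- a₀) :* b :=
             α :* b :+ (a :* b₀ :- a₀ :* b)) refl b₀ (a x) α a₀ (b x))))
        (+-pos-nonneg (*-pos 0<α (0<b (Same⇒≢s x-Same))) (last-ratio x-Same))))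

      Other⇒x₀< : ∀ {x} → Other x → D q x₀ < D q x
      Other⇒x₀< {x} other@(_ , _ , x≢s) = 0<y-x⇒x<y (*-cancelˡ-pos (<⇒≤ 0<W) (<-respʳ (begin
        b₀ * (a x - α) + (α - a₀) * b x
          ≈⟨ solve 5 (λ b₀ a α a₀ b → b₀ :* (a :- α) :+ (α :- a₀) :* b :=
               (b₀ :* a :+ (α :- a₀) :* b) :- (b₀ :* a₀ :+ (α :- a₀) :* b₀)) refl b₀ (a x) α a₀ (b x) ⟩
        (b₀ * a x + (α - a₀) * b x) - (b₀ * a₀ + (α - a₀) * b₀)
          ≈⟨ +-cong (gap x) (-‿cong (gap x₀)) ⟨
        W * (D q x - D q s) - W * (D q x₀ - D q s)
          ≈⟨ solve 4 (λ w x s z → w :* (x :- s) :- w :* (z :- s) :=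
               w :* (x :- z)) refl W (D q x) (D q s) (D q x₀) ⟩
        W * (D q x - D q x₀) ∎)
        (+-nonneg-pos (*-nonneg (<⇒≤ 0<b₀) (x≤y⇒0≤y-x (proj₂ (proj₂ bound) x other))) (*-pos 0<α-a₀ (0<b x≢s)))))

      s< : ∀ {x} → x ∈ X → x ≢ s → D q s < D q x
      s< {x} x∈X x≢s with em {P = class x ≡ class r}
      ... | yes x≡r = Same⇒s< (x∈X , x≡r)
      ... | no  x≢r = <-≤-trans (Same⇒s< x₀-Same) (<⇒≤ (Other⇒x₀< (x∈X , x≢r , x≢s)))

      ∃nearest-s : ∃ (Nearest T X q)
      ∃nearest-s = s , D≤⇒Nearest s∈X λ j j∈X → min j j∈X
        where
        min : ∀ j → j ∈ X → D q s ≤ D q j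
        min j j∈X with j ≟ s
        ... | yes ≡.refl = ≤-refl
        ... | no  j≢s    = <⇒≤ (s< j∈X j≢s)

      nearest-s : ∀ i → i ∈ Nearest T X q → class i ≡ class s
      nearest-s i i∈@(i∈X , _) with i ≟ s
      ... | yes ≡.refl = ≡.refl
      ... | no  i≢s    = contradiction (Nearest⇒D≤ i∈ s∈X) (<⇒≱ (s< i∈X i≢s))

      ∃nearest-r : ∃ (Nearest T (_∖_ T X s) q)
      ∃nearest-r with argmin (D q) (_∖_ T X s) (r , r∈X , s≢r ∘ ≡.cong class ∘ ≡.sym)
      ... | i , i∈ , min = i , D≤⇒Nearest i∈ min

      nearest-r : ∀ i → i ∈ Nearest T (_∖_ T X s) q → class i ≡ class r
      nearest-r i i∈@((i∈X , i≢s) , _) with em {P = class i ≡ class r}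
      ... | yes i≡r = i≡r
      ... | no  i≢r = contradiction (Nearest⇒D≤ i∈ (proj₁ x₀-Same , Same⇒≢s x₀-Same))
        (<⇒≱ (Other⇒x₀< (i∈X , i≢r , i≢s)))

    class-≢ : ∀ {i j} → class i ≢ class j → ¬ point i ≋ point j
    class-≢ i≢j = point-≢ (i≢j ∘ ≡.cong class)

    -- Scale a functional separating `y` from the rest of S_r until the hyperplane 2⟨u - r, _ - r⟩ =
    -- 1 passes through `y`. Then r and s are equidistant from `u`, and the inverted points strictly
    -- below the hyperplane come from points strictly farther away.
    Extreme⇒wall : ∀ {r s y} → class s ≢ class r → y ≋ invert (point r) (point s) → Extreme (S T r) y →
      ∃[ u ] D u r ≤ D u s × (∀ x → class x ≢ class r → x ≢ s → D u s < D u x)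
    Extreme⇒wall {r} {s} {y} s≢r y≋ extreme = u , D-mono s≢r (≤-reflexive s-tight) , λ x x≢r x≢s →
      ≤-<-trans (≤-reflexive (sym (D-tight s≢r s-tight))) (D-strict x≢r (strict x≢r x≢s))
      where
      ρ = point r
      Member : Fin n → Set
      Member i = class i ≢ class r × i ≢ s
      -- Indices outside `Member` default to the centre, itself a point of S_r, so a family over all
      -- of `Fin n` can be separated from `y`.
      p : Fin n → Point d
      p i with em {P = Member i}
      ... | yes _ = invert ρ (point i)
      ... | no  _ = ρ
      p-Member : ∀ {i} → Member i → p i ≡ invert ρ (point i)
      p-Member {i} mi with em {P = Member i}
      ... | yes _   = ≡.refl
      ... | no  ¬mi = contradiction mi ¬mi
      p-centre : p r ≡ ρ
      p-centre with em {P = Member r}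
      ... | yes (r≢r , _) = contradiction ≡.refl r≢r
      ... | no  _         = ≡.refl
      p∈S : ∀ i → p i ∈ S T r
      p∈S i with em {P = Member i}
      ... | yes (i≢r , _) = i , inverted i≢r λ k → refl
      ... | no  _         = r , centre ≡.refl λ k → refl
      p≉y : ∀ i → ¬ p i ≋ y
      p≉y i p≋y with em {P = Member i}
      ... | yes (i≢r , i≢s) = point-≢ i≢s (invert-injective (class-≢ i≢r) (class-≢ s≢r) λ k → trans (p≋y k) (y≋ k))
      ... | no  _           = invert≉centre (class-≢ s≢r) λ k → trans (p≋y k) (y≋ k)

      separation = Extreme⇒separated {S = S T r} extreme p p∈S p≉y ρ
      g = proj₁ separation
      h = proj₁ (proj₂ separation)
      p≤h = proj₁ (proj₂ (proj₂ separation))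
      H : Fin n → Carrier
      H x = ⟨ g , invert ρ (point x) ⊝ ρ ⟩
      h<Hs : h < H s
      h<Hs = <-respʳ (⟨⟩-congʳ g λ k → +-congʳ (y≋ k)) (proj₂ (proj₂ (proj₂ separation)))
      -- The functional is 0 at the centre, which is among the separated points. This makes `H s`
      -- positive, so the scaling by `c` is possible.
      0≤h : 0# ≤ h
      0≤h = ≤-respˡ (trans (⟨⟩-congʳ g λ k → x≈y⇒x-y≈0 (≋-reflexive p-centre k))
        (sum-zero λ k → zeroʳ (g k))) (p≤h r)
      0<Hs : 0# < H s
      0<Hs = ≤-<-trans 0≤h h<Hs
      H<Hs : ∀ {x} → class x ≢ class r → x ≢ s → H x < H s
      H<Hs {x} x≢r x≢s = ≤-<-trans
        (≤-respˡ (⟨⟩-congʳ g λ k → +-congʳ (≋-reflexive (p-Member (x≢r , x≢s)) k)) (p≤h x)) h<Hs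

      0<2Hs = *-pos 0<2 0<Hs
      c = (2# * H s) ⁻¹
      u : Point d
      u k = ρ k + c * g k
      I : Fin n → Carrier
      I x = 2# * ⟨ u ⊝ ρ , invert ρ (point x) ⊝ ρ ⟩
      I≈ : ∀ x → I x ≈ c * (2# * H x)
      I≈ x = begin
        2# * ⟨ u ⊝ ρ , z ⟩
          ≈⟨ *-congˡ (sum-cong-≋ λ k → solve 4 (λ r c g z → ((r :+ c :* g) :- r) :* z :=
               c :* (g :* z)) refl (ρ k) c (g k) (z k)) ⟩
        2# * (sum λ k → c * (g k * z k))  ≈⟨ *-congˡ (*-distribˡ-sum c (λ k → g k * z k)) ⟨
        2# * (c * H x)
          ≈⟨ solve 2 (λ c h → con (+ 2) :* (c :* h) := c :* (con (+ 2) :* h)) refl c (H x) ⟩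
        c * (2# * H x)                    ∎
        where z = invert ρ (point x) ⊝ ρ
      s-tight : I s ≈ 1#
      s-tight = trans (I≈ s) (*-inverseˡ _ (pos⇒≉0 0<2Hs))
      strict : ∀ {x} → class x ≢ class r → x ≢ s → I x < 1#
      strict {x} x≢r x≢s = <-by (begin
        1# - I x                          ≈⟨ +-cong (trans (sym s-tight) (I≈ s)) (-‿cong (I≈ x)) ⟩
        c * (2# * H s) - c * (2# * H x)
          ≈⟨ solve 3 (λ c a b → c :* (con (+ 2) :* a) :- c :* (con (+ 2) :* b) :=
               c :* con (+ 2) :* (a :- b)) refl c (H s) (H x) ⟩
        c * 2# * (H s - H x)              ∎)
        (*-pos (*-pos (⁻¹-pos 0<2Hs) 0<2) (x<y⇒0<y-x (H<Hs x≢r x≢s)))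

      D-mono : ∀ {x} → class x ≢ class r → I x ≤ 1# → D u r ≤ D u x
      D-mono {x} x≢r I≤1 = ≤-by (‖-‖²-invert (class-≢ x≢r) u) (*-nonneg (‖-‖²-nonneg (point x) ρ) (x≤y⇒0≤y-x I≤1))
      D-strict : ∀ {x} → class x ≢ class r → I x < 1# → D u r < D u x
      D-strict x≢r I<1 = <-by (‖-‖²-invert (class-≢ x≢r) u) (*-pos (‖-‖²-pos (class-≢ x≢r)) (x<y⇒0<y-x I<1))
      D-tight : ∀ {x} → class x ≢ class r → I x ≈ 1# → D u r ≈ D u x
      D-tight x≢r I≈1 = sym (x-y≈0⇒x≈y (trans (‖-‖²-invert (class-≢ x≢r) u)
        (trans (*-congˡ (x≈y⇒x-y≈0 (sym I≈1))) (zeroʳ _))))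

    -- A linear functional attains its maximum over S r at an extreme point; among
    -- all maximisers, one of maximal norm is extreme.
    extreme-points-suffice : ∀ r q →
      (∀ i y → class i ≢ class r → SPoint T r i y → Extreme (S T r) y → D q r ≤ D q i) →
      ∀ x → class x ≢ class r → D q r ≤ D q x
    extreme-points-suffice r q hyp x x≢r = ≤-by (‖-‖²-invert (class-≢ x≢r) q)
      (*-nonneg (‖-‖²-nonneg (point x) ρ) (x≤y⇒0≤y-x (≤-trans (2*-mono (⊝-mono
        (≤-respˡ (⟨⟩-congʳ φ (≋-reflexive (z-inverted x≢r))) (f≤ x (inj₂ x≢r))))) y-bound)))
      where
      ρ = point r
      φ = q ⊝ ρ
      Member : Pred (Fin n) 0ℓ
      Member i = i ≡ r ⊎ class i ≢ class r
      z : Fin n → Point d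
      z i with i ≟ r
      ... | yes _ = ρ
      ... | no  _ = invert ρ (point i)
      z-inverted : ∀ {i} → class i ≢ class r → z i ≡ invert ρ (point i)
      z-inverted {i} i≢r with i ≟ r
      ... | yes ≡.refl = contradiction ≡.refl i≢r
      ... | no  _      = ≡.refl
      z-centre : z r ≡ ρ
      z-centre with r ≟ r
      ... | yes _   = ≡.refl
      ... | no  r≢r = contradiction ≡.refl r≢r
      z-SPoint : ∀ {i} → Member i → SPoint T r i (z i)
      z-SPoint (inj₁ ≡.refl) = centre ≡.refl (≋-reflexive z-centre)
      z-SPoint (inj₂ i≢r)    = inverted i≢r (≋-reflexive (z-inverted i≢r))
      S⇒z : ∀ {p} → p ∈ S T r → ∃[ i ] Member i × p ≋ z i
      S⇒z (i , centre ≡.refl p≋) = i , inj₁ ≡.refl , λ k → trans (p≋ k) (≋-reflexive (≡.sym z-centre) k)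
      S⇒z (i , inverted i≢r p≋)  = i , inj₂ i≢r , λ k → trans (p≋ k) (≋-reflexive (≡.sym (z-inverted i≢r)) k)

      max₁ = argmax (λ i → ⟨ φ , z i ⟩) Member (r , inj₁ ≡.refl)
      i₁ = proj₁ max₁
      Maximiser : Pred (Fin n) 0ℓ
      Maximiser i = Member i × ⟨ φ , z i ⟩ ≈ ⟨ φ , z i₁ ⟩
      max₂ = argmax (λ i → ⟨ z i , z i ⟩) Maximiser (i₁ , proj₁ (proj₂ max₁) , refl)
      i₂ = proj₁ max₂
      i₂-Member = proj₁ (proj₁ (proj₂ max₂))
      φi₂≈ = proj₂ (proj₁ (proj₂ max₂))
      y = z i₂
      f≤ : ∀ i → Member i → ⟨ φ , z i ⟩ ≤ ⟨ φ , y ⟩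
      f≤ i mi = ≤-respʳ (sym φi₂≈) (proj₂ (proj₂ max₁) i mi)

      norm≤ : ∀ {p} → p ∈ S T r → ⟨ φ , p ⟩ ≈ ⟨ φ , y ⟩ → ⟨ p , p ⟩ ≤ ⟨ y , y ⟩
      norm≤ p∈S φp≈ with S⇒z p∈S
      ... | i , mi , p≋ = ≤-respˡ (sum-cong-≋ λ k → sym (*-cong (p≋ k) (p≋ k)))
        (proj₂ (proj₂ max₂) i (mi , trans (⟨⟩-congʳ φ λ k → sym (p≋ k)) (trans φp≈ φi₂≈)))

      y-Extreme : Extreme (S T r) y
      -- Ties are broken by the functional `⟨ y , _ ⟩`: since ‖p - y‖² = ‖p‖² + ‖y‖² - 2⟨y, p⟩ and
      -- ‖p‖ ≤ ‖y‖ among the maximisers of `φ`, ⟨y, p⟩ is at most ⟨y, y⟩, with equality only for p =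
      -- y.
      y-Extreme = lexicographic-max⇒Extreme {S = S T r} φ y (i₂ , z-SPoint i₂-Member)
        (λ p∈S → let i , mi , p≋ = S⇒z p∈S in ≤-respˡ (⟨⟩-congʳ φ λ k → sym (p≋ k)) (f≤ i mi))
        (λ {p} p∈S φp≈ → 0≤y-x⇒x≤y (*-cancelˡ-nonneg 0<2 (≤-respʳ (trans (+-congˡ (polarization p y))
            (solve 3 (λ a b c → (b :- a) :+ (a :+ b :- con (+ 2) :* c) :=
                 con (+ 2) :* (b :- c)) refl ⟨ p , p ⟩ ⟨ y , y ⟩ ⟨ y , p ⟩))
          (+-nonneg (x≤y⇒0≤y-x (norm≤ p∈S φp≈)) (‖-‖²-nonneg p y)))))
        (λ {p} p∈S φp≈ ψp≈ → ‖-‖²≈0⇒≋ (antisym (≤-by (begin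
            0# - ‖ p - y ‖²                                            ≈⟨ +-congˡ (-‿cong (polarization p y)) ⟩
            0# - (⟨ p , p ⟩ + ⟨ y , y ⟩ - 2# * ⟨ y , p ⟩)
              ≈⟨ +-congˡ (-‿cong (+-congˡ (-‿cong (*-congˡ ψp≈)))) ⟩
            0# - (⟨ p , p ⟩ + ⟨ y , y ⟩ - 2# * ⟨ y , y ⟩)
              ≈⟨ solve 2 (λ a b → con (+ 0) :- (a :+ b :- con (+ 2) :* b) := b :- a) refl ⟨ p , p ⟩ ⟨ y , y ⟩ ⟩
            ⟨ y , y ⟩ - ⟨ p , p ⟩                                      ∎) (x≤y⇒0≤y-x (norm≤ p∈S φp≈)))
          (‖-‖²-nonneg p y)))

      2*-mono : ∀ {a b} → a ≤ b → 2# * a ≤ 2# * b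
      2*-mono a≤b = ≤-by (solve 2 (λ a b → con (+ 2) :* b :- con (+ 2) :* a := con (+ 2) :* (b :- a)) refl _ _)
        (*-nonneg (<⇒≤ 0<2) (x≤y⇒0≤y-x a≤b))

      ⊝-mono : ∀ {v w} → ⟨ φ , v ⟩ ≤ ⟨ φ , w ⟩ → ⟨ φ , v ⊝ ρ ⟩ ≤ ⟨ φ , w ⊝ ρ ⟩
      ⊝-mono {v} {w} v≤w = ≤-respˡ (sym (⟨⟩-⊝ φ v ρ)) (≤-respʳ (sym (⟨⟩-⊝ φ w ρ)) (+-monoˡ-≤ _ v≤w))

      -- If the maximiser is the centre, the left side is 0; otherwise this is `hyp` at `i₂`, read
      -- through the inversion.
      y-bound : 2# * ⟨ φ , y ⊝ ρ ⟩ ≤ 1#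
      y-bound with i₂-Member
      ... | inj₁ i₂≡r = ≤-respˡ (sym (trans (*-congˡ (trans (⟨⟩-congʳ φ λ k → x≈y⇒x-y≈0
              (≋-reflexive (≡.trans (≡.cong z i₂≡r) z-centre) k)) (sum-zero λ k → zeroʳ (φ k)))) (zeroʳ 2#))) (<⇒≤ 0<1)
      ... | inj₂ i₂≢r = ≤-respˡ (*-congˡ (⟨⟩-congʳ φ λ k → +-congʳ (≋-reflexive (≡.sym (z-inverted i₂≢r)) k)))
        (0≤y-x⇒x≤y (*-cancelˡ-nonneg (‖-‖²-pos (class-≢ i₂≢r)) (≤-respʳ (‖-‖²-invert (class-≢ i₂≢r) q)
          (x≤y⇒0≤y-x (hyp i₂ y i₂≢r (z-SPoint i₂-Member) y-Extreme)))))

-- Spanning trees and edge exchange.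

module SpanningTree (em : ExcludedMiddle 0ℓ) {n : ℕ} where
  open Graph

  -- Adjacency is Boolean; excluded middle lets edge operations be specified by propositions
  -- instead.
  fromRelation : (P : Rel (Fin n) 0ℓ) → (∀ {i j} → P i j → P j i) → (∀ {i} → ¬ P i i) → Graph n
  fromRelation P P-sym P-irrefl = record
    { adj        = λ i j → ⌊ em {P = P i j} ⌋
    ; adj-sym    = symmetric
    ; adj-irrefl = irreflexive
    }
    where
    symmetric : ∀ i j → ⌊ em {P = P i j} ⌋ ≡ ⌊ em {P = P j i} ⌋
    symmetric i j with em {P = P i j} | em {P = P j i}
    ... | yes _  | yes _  = ≡.refl
    ... | no  _  | no  _  = ≡.refl
    ... | yes p  | no  ¬q = contradiction (P-sym p) ¬q
    ... | no  ¬p | yes q  = contradiction (P-sym q) ¬p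
    irreflexive : ∀ i → ⌊ em {P = P i i} ⌋ ≡ false
    irreflexive i with em {P = P i i}
    ... | yes p = contradiction p P-irrefl
    ... | no  _ = ≡.refl

  module _ {P : Rel (Fin n) 0ℓ} where

    Adj⁺ : ∀ {i j} → P i j → ⌊ em {P = P i j} ⌋ ≡ true
    Adj⁺ {i} {j} p with em {P = P i j}
    ... | yes _  = ≡.refl
    ... | no  ¬p = contradiction p ¬p

    Adj⁻ : ∀ {i j} → ⌊ em {P = P i j} ⌋ ≡ true → P i j
    Adj⁻ {i} {j} eq with em {P = P i j}
    ... | yes p = p

  Adj-sym : ∀ G {i j} → Adj {n} G i j → Adj G j i
  Adj-sym G {i} {j} = ≡.trans (adj-sym G j i)

  Adj-irrefl : ∀ G {i} → ¬ Adj {n} G i i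
  Adj-irrefl G {i} eq with () ← ≡.trans (≡.sym eq) (adj-irrefl G i)

  Joins : Fin n → Fin n → Rel (Fin n) 0ℓ
  Joins u v i j = (i ≡ u × j ≡ v) ⊎ (i ≡ v × j ≡ u)

  Joins-sym : ∀ {u v i j} → Joins u v i j → Joins u v j i
  Joins-sym (inj₁ (i≡u , j≡v)) = inj₂ (j≡v , i≡u)
  Joins-sym (inj₂ (i≡v , j≡u)) = inj₁ (j≡u , i≡v)

  Joins-irrefl : ∀ {u v} → u ≢ v → ∀ {i} → ¬ Joins u v i i
  Joins-irrefl u≢v (inj₁ (≡.refl , u≡v)) = u≢v u≡v
  Joins-irrefl u≢v (inj₂ (≡.refl , v≡u)) = u≢v (≡.sym v≡u)

  edge : ∀ u v → u ≢ v → Graph n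
  edge u v u≢v = fromRelation (Joins u v) Joins-sym (Joins-irrefl u≢v)

  remove : Graph n → Fin n → Fin n → Graph n
  remove G u v = fromRelation (λ i j → Adj G i j × ¬ Joins u v i j)
    (λ (ij , ¬J) → Adj-sym G ij , ¬J ∘ Joins-sym) (Adj-irrefl G ∘ proj₁)

  add : Graph n → ∀ u v → u ≢ v → Graph n
  add G u v u≢v = fromRelation (λ i j → Adj G i j ⊎ Joins u v i j)
    (Sum.map (Adj-sym G) Joins-sym) Sum.[ Adj-irrefl G , Joins-irrefl u≢v ]

  infix 4 _⊆_
  _⊆_ : Rel (Graph n) 0ℓ
  H ⊆ G = ∀ {i j} → Adj H i j → Adj G i j

  remove⁺ : ∀ G {u v i j} → Adj G i j → ¬ Joins u v i j → Adj (remove G u v) i j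
  remove⁺ G {u} {v} ij ¬J = Adj⁺ {P = λ i j → Adj G i j × ¬ Joins u v i j} (ij , ¬J)

  remove⁻ : ∀ G {u v i j} → Adj (remove G u v) i j → Adj G i j × ¬ Joins u v i j
  remove⁻ G {u} {v} = Adj⁻ {P = λ i j → Adj G i j × ¬ Joins u v i j}

  add⁺ : ∀ G {u v} u≢v i j → Adj G i j ⊎ Joins u v i j → Adj (add G u v u≢v) i j
  add⁺ G {u} {v} u≢v i j = Adj⁺ {P = λ i j → Adj G i j ⊎ Joins u v i j}

  add⁻ : ∀ G {u v} u≢v i j → Adj (add G u v u≢v) i j → Adj G i j ⊎ Joins u v i j
  add⁻ G {u} {v} u≢v i j = Adj⁻ {P = λ i j → Adj G i j ⊎ Joins u v i j}

  edge⁺ : ∀ {u v} u≢v i j → Joins u v i j → Adj (edge u v u≢v) i j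
  edge⁺ {u} {v} u≢v i j = Adj⁺ {P = Joins u v}

  edge⁻ : ∀ {u v} u≢v i j → Adj (edge u v u≢v) i j → Joins u v i j
  edge⁻ {u} {v} u≢v i j = Adj⁻ {P = Joins u v}

  remove-⊆ : ∀ G {u v} → remove G u v ⊆ G
  remove-⊆ G = proj₁ ∘ remove⁻ G

  remove-mono : ∀ {H G u v} → H ⊆ G → remove H u v ⊆ remove G u v
  remove-mono {H} {G} H⊆G ij = let ij′ , ¬J = remove⁻ H ij in remove⁺ G (H⊆G ij′) ¬J

  Connected-mono : ∀ (H G : Graph n) → H ⊆ G → Connected H → Connected G
  Connected-mono H G H⊆G connected i j = Star.map H⊆G (connected i j)

  path-sym : ∀ G {i j} → Star (Adj {n} G) i j → Star (Adj G) j i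
  path-sym G = Star.reverse (Adj-sym G)

  bypass⇒Connected-remove : ∀ G {u v} → Star (Adj (remove G u v)) u v → Connected G → Connected (remove G u v)
  bypass⇒Connected-remove G {u} {v} bypass connected i j = (step ⋆) (connected i j)
    where
    step : ∀ {a b} → Adj G a b → Star (Adj (remove G u v)) a b
    step {a} {b} ab with em {P = Joins u v a b}
    ... | yes (inj₁ (≡.refl , ≡.refl)) = bypass
    ... | yes (inj₂ (≡.refl , ≡.refl)) = path-sym (remove G u v) bypass
    ... | no  ¬J                       = remove⁺ G ab ¬J ◅ ε

  Cycle⇒redundant-edge : ∀ {G : Graph n} → Connected G → Cycle G →
    ∃[ u ] ∃[ v ] Adj G u v × Connected (remove G u v)
  Cycle⇒redundant-edge {G} connected C = _ , _ , closing ,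
    bypass⇒Connected-remove G (path-sym G′ (along (fromℕ (2 ℕ.+ k)))) connected
    where
    open Cycle C
    G′ = remove G (vertex (fromℕ (2 ℕ.+ k))) (vertex zero)
    ¬Joins-consecutive : ∀ i → ¬ Joins (vertex (fromℕ (2 ℕ.+ k))) (vertex zero) (vertex (inject₁ i)) (vertex (suc i))
    ¬Joins-consecutive i       (inj₁ (eq , _))  = fromℕ≢inject₁ (≡.sym (distinct eq))
    -- A cycle has at least three vertices, so its second vertex is not its last.
    ¬Joins-consecutive zero    (inj₂ (_  , eq)) with () ← distinct eq
    ¬Joins-consecutive (suc i) (inj₂ (eq , _))  with () ← distinct eq
    along : ∀ i → Star (Adj G′) (vertex zero) (vertex i)
    along = <-weakInduction (λ i → Star (Adj G′) (vertex zero) (vertex i)) ε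
      λ i path → path ◅◅ remove⁺ G (consecutive i) (¬Joins-consecutive i) ◅ ε

  -- One pass over the pairs suffices: an edge that cannot be spared stays indispensable when
  -- further edges go, because connectedness of a subgraph passes to the larger graph.
  prune : ∀ (L : List (Fin n × Fin n)) G → Connected G →
    ∃[ H ] H ⊆ G × Connected H × (∀ u v → (u , v) List.∈ L → Adj H u v → ¬ Connected (remove H u v))
  prune []                 G connected = G , id , connected , λ _ _ ()
  prune ((u , v) List.∷ L) G connected with prune L G connected
  ... | H , H⊆G , H-connected , H-minimal with em {P = Connected (remove H u v)}
  ...   | no ¬connected = H , H⊆G , H-connected , λ where
    _ _ (here ≡.refl) _  → ¬connected
    a b (there ab∈L)  ab → H-minimal a b ab∈L ab
  ...   | yes connected′ = remove H u v , H⊆G ∘ remove-⊆ H , connected′ , λ where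
    _ _ (here ≡.refl) uv → contradiction (inj₁ (≡.refl , ≡.refl)) (proj₂ (remove⁻ H uv))
    a b (there ab∈L)  ab → H-minimal a b ab∈L (remove-⊆ H ab) ∘
      Connected-mono (remove (remove H u v) a b) (remove H a b) (remove-mono {remove H u v} {H} (remove-⊆ H))

  spanning-tree : ∀ G → Connected G → ∃[ H ] H ⊆ G × IsTree H
  spanning-tree G connected with prune (cartesianProduct (allFin n) (allFin n)) G connected
  ... | H , H⊆G , H-connected , H-minimal = H , H⊆G , H-connected , λ C →
    let u , v , uv , c = Cycle⇒redundant-edge H-connected C
    in H-minimal u v (∈-cartesianProduct⁺ (∈-allFin u) (∈-allFin v)) uv c

  module _ {G : Graph n} (connected : Connected G) {u v : Fin n} where

    -- A path from `x` to `u`, cut at its first use of the removed edge, ends at `u` or at `v`.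
    remove-two-components : ∀ x → Star (Adj (remove G u v)) x u ⊎ Star (Adj (remove G u v)) x v
    remove-two-components x = go (connected x u)
      where
      go : ∀ {x} → Star (Adj G) x u → Star (Adj (remove G u v)) x u ⊎ Star (Adj (remove G u v)) x v
      go ε = inj₁ ε
      go {x} (_◅_ {j = y} xy path) with em {P = Joins u v x y}
      ... | yes (inj₁ (≡.refl , _)) = inj₁ ε
      ... | yes (inj₂ (≡.refl , _)) = inj₂ ε
      ... | no  ¬J = Sum.map (remove⁺ G xy ¬J ◅_) (remove⁺ G xy ¬J ◅_) (go path)

    exchange-Connected : ∀ {x} (x≢v : x ≢ v) → Star (Adj (remove G u v)) x u →
      Connected (add (remove G u v) x v x≢v)
    exchange-Connected {x} x≢v x~u i j = to-v i ◅◅ path-sym H (to-v j)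
      where
      G′ = remove G u v
      H = add G′ x v x≢v
      lift : G′ ⊆ H
      lift ij = add⁺ G′ x≢v _ _ (inj₁ ij)
      to-v : ∀ i → Star (Adj H) i v
      to-v i with remove-two-components i
      ... | inj₂ i~v = Star.map lift i~v
      ... | inj₁ i~u = Star.map lift (i~u ◅◅ path-sym G′ x~u) ◅◅ add⁺ G′ x≢v x v (inj₂ (inj₁ (≡.refl , ≡.refl))) ◅ ε

-- The minimum spanning tree and the identified points.

module Relevance (em : ExcludedMiddle 0ℓ) (ℝ : RealNumbers) where
  open RealNumbers ℝ hiding (zero; distrib)
  open NearestNeighbor ℝ
  open IntegerCoefficients.Solver commutativeRing
  open SetoidReasoning setoid
  open SemiringSum semiring using (sum-cong-≋; ∑-distrib-+)
  open OrderedField em ℝ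
  open Convexity em ℝ
  open Geometry em ℝ
  open Graph using (adj; Adj; Connected)

  module _ {d n : ℕ} {K : Set} (T : TrainingSet d n K) where
    open TrainingSet T
    open SpanningTree em {n}

    ℓ : Fin n → Fin n → Carrier
    ℓ i j = dist (point i) (point j)

    ℓ-nonneg : ∀ i j → 0# ≤ ℓ i j
    ℓ-nonneg i j = √-nonneg (‖-‖²-nonneg (point i) (point j))

    ℓ-sym : ∀ i j → ℓ i j ≈ ℓ j i
    ℓ-sym i j = antisym (ℓ≤ i j) (ℓ≤ j i)
      where
      ℓ≤ : ∀ i j → ℓ i j ≤ ℓ j i
      ℓ≤ i j = √-mono-≤ (‖-‖²-nonneg (point i) (point j)) (‖-‖²-nonneg (point j) (point i))
        (≤-reflexive (‖-‖²-sym (point i) (point j)))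

    term : Graph n → Fin n → Fin n → Carrier
    term G i j = if ⌊ i <? j ⌋ ∧ adj G i j then ℓ i j else 0#

    term-Adj : ∀ G {i j} → i Fin.< j → Adj G i j → term G i j ≈ ℓ i j
    term-Adj G {i} {j} i<j ij with i <? j
    ... | yes _  rewrite ij = refl
    ... | no i≮j = contradiction i<j i≮j

    term-¬Adj : ∀ G {i j} → ¬ Adj G i j → term G i j ≈ 0#
    term-¬Adj G {i} {j} ¬ij with i <? j
    ... | yes _ rewrite ¬-not ¬ij = refl
    ... | no  _ = refl

    term-≮ : ∀ G {i j} → ¬ i Fin.< j → term G i j ≈ 0#
    term-≮ G {i} {j} i≮j with i <? j
    ... | yes i<j = contradiction i<j i≮j
    ... | no  _   = refl

    term-mono : ∀ G H i j → (Adj G i j → Adj H i j) → term G i j ≤ term H i j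
    term-mono G H i j G⇒H with em {P = i Fin.< j}
    ... | no i≮j = ≤-reflexive (trans (term-≮ G i≮j) (sym (term-≮ H i≮j)))
    ... | yes i<j with em {P = Adj G i j} | em {P = Adj H i j}
    ...   | yes g | yes h = ≤-reflexive (trans (term-Adj G i<j g) (sym (term-Adj H i<j h)))
    ...   | yes g | no ¬h = contradiction (G⇒H g) ¬h
    ...   | no ¬g | yes h = ≤-respˡ (sym (term-¬Adj G ¬g)) (≤-respʳ (sym (term-Adj H i<j h)) (ℓ-nonneg i j))
    ...   | no ¬g | no ¬h = ≤-reflexive (trans (term-¬Adj G ¬g) (sym (term-¬Adj H ¬h)))

    weight-mono : ∀ {G H} → G ⊆ H → weight T G ≤ weight T H
    weight-mono {G} {H} G⊆H = sum-mono-≤ λ i → sum-mono-≤ λ j → term-mono G H i j G⊆H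

    weight-edge-< : ∀ G {u v} → u Fin.< v → (∀ i j → Adj G i j → Joins u v i j) → Adj G u v → weight T G ≈ ℓ u v
    weight-edge-< G {u} {v} u<v G⇒J uv = trans
      (sum-single u λ i i≢u → sum-zero λ j → zero-row i j i≢u)
      (trans (sum-single v zero-entry) (term-Adj G u<v uv))
      where
      zero-row : ∀ i j → i ≢ u → term G i j ≈ 0#
      zero-row i j i≢u with em {P = Adj G i j}
      ... | no ¬ij = term-¬Adj G ¬ij
      ... | yes ij with G⇒J i j ij
      ...   | inj₁ (i≡u , _)         = contradiction i≡u i≢u
      ...   | inj₂ (≡.refl , ≡.refl) = term-≮ G (<-asym u<v)
      zero-entry : ∀ j → j ≢ v → term G u j ≈ 0#
      zero-entry j j≢v = term-¬Adj G λ uj →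
        Sum.[ j≢v ∘ proj₂ , (λ (u≡v , j≡u) → j≢v (≡.trans j≡u u≡v)) ] (G⇒J u j uj)

    weight-edge : ∀ {u v} (u≢v : u ≢ v) → weight T (edge u v u≢v) ≈ ℓ u v
    weight-edge {u} {v} u≢v with <-cmp u v
    ... | tri≈ _ u≡v _ = contradiction u≡v u≢v
    ... | tri< u<v _ _ = weight-edge-< (edge u v u≢v) u<v (edge⁻ u≢v) (edge⁺ u≢v u v (inj₁ (≡.refl , ≡.refl)))
    ... | tri> _ _ v<u = trans
      (weight-edge-< (edge u v u≢v) v<u (λ i j → Sum.swap ∘ edge⁻ u≢v i j) (edge⁺ u≢v v u (inj₂ (≡.refl , ≡.refl))))
      (ℓ-sym v u)

    -- Compared pair by pair, with the removed edge carried to the left to avoid subtraction. An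
    -- inequality also covers the case that the added edge is already present.
    weight-exchange : ∀ G {u v x} (u≢v : u ≢ v) (x≢v : x ≢ v) → Adj G u v →
      weight T (add (remove G u v) x v x≢v) + ℓ u v ≤ weight T G + ℓ x v
    weight-exchange G {u} {v} {x} u≢v x≢v uv =
      ≤-respˡ (trans (weight-+ H E) (+-congˡ (weight-edge u≢v)))
        (≤-respʳ (trans (weight-+ G F) (+-congˡ (weight-edge x≢v)))
          (sum-mono-≤ λ i → sum-mono-≤ λ j → term≤ i j em em))
      where
      H = add (remove G u v) x v x≢v
      E = edge u v u≢v
      F = edge x v x≢v
      weight-+ : ∀ G H → (sum λ i → sum λ j → term G i j + term H i j) ≈ weight T G + weight T H
      weight-+ G H = trans (sum-cong-≋ λ i → ∑-distrib-+ (term G i) (term H i))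
        (∑-distrib-+ (λ i → sum (term G i)) (λ i → sum (term H i)))
      E⇒G : ∀ {i j} → Joins u v i j → Adj G i j
      E⇒G (inj₁ (≡.refl , ≡.refl)) = uv
      E⇒G (inj₂ (≡.refl , ≡.refl)) = Adj-sym G uv
      term≤ : ∀ i j → Dec (Joins x v i j) → Dec (Joins u v i j) → term H i j + term E i j ≤ term G i j + term F i j
      term≤ i j (yes xv) _ = ≤-respˡ (+-comm _ _)
        (+-mono-≤ (term-mono E G i j (E⇒G ∘ edge⁻ u≢v i j)) (term-mono H F i j λ _ → edge⁺ x≢v i j xv))
      term≤ i j (no ¬xv) (yes J) = ≤-respˡ (+-comm _ _)
        (+-mono-≤ (term-mono E G i j λ _ → E⇒G J) (term-mono H F i j λ h → contradiction
          (Sum.[ (λ g → contradiction J (proj₂ (remove⁻ G g))) , id ] (add⁻ (remove G u v) x≢v i j h)) ¬xv))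
      term≤ i j (no ¬xv) (no ¬J) = +-mono-≤
        (term-mono H G i j λ h → Sum.[ remove-⊆ G , (λ xv → contradiction xv ¬xv) ] (add⁻ (remove G u v) x≢v i j h))
        (term-mono E F i j λ e → contradiction (edge⁻ u≢v i j e) ¬J)

    module _ {G : Graph n} (mst : IsEuclideanMST T G) where
      connected : Connected G
      connected = proj₁ (proj₁ mst)

      -- The exchanged graph is shown only to be connected. A spanning tree inside it weighs no
      -- more, lengths being nonnegative, and that tree competes with `G`.
      exchange-≤ : ∀ {u v x} → Adj G u v → x ≢ v → Star (Adj (remove G u v)) x u → ℓ u v ≤ ℓ x v
      exchange-≤ {u} {v} {x} uv x≢v x~u
        with spanning-tree (add (remove G u v) x v x≢v) (exchange-Connected {G} connected x≢v x~u)
      ... | H , H⊆ , H-tree = ≤-by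
        (solve 3 (λ g a b → b :- a := (g :+ b) :- (g :+ a)) refl (weight T G) (ℓ u v) (ℓ x v))
        (x≤y⇒0≤y-x (≤-trans
          (+-monoˡ-≤ (ℓ u v) (≤-trans (proj₂ mst H H-tree) (weight-mono {H} {add (remove G u v) x v x≢v} H⊆)))
          (weight-exchange G (λ { ≡.refl → Adj-irrefl G uv }) x≢v uv)))

      tree-edge-≤ : ∀ {u v x} → Adj G u v → x ≢ u → x ≢ v →
        ‖ point v - point u ‖² ≤ ‖ point v - point x ‖² ⊎ ‖ point v - point u ‖² ≤ ‖ point u - point x ‖²
      tree-edge-≤ {u} {v} {x} uv x≢u x≢v with remove-two-components {G} connected {u} {v} x
      ... | inj₁ x~u = inj₁ (dist≤⇒‖-‖²≤ (point v) (point u) (point x)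
        (≤-respˡ (ℓ-sym u v) (≤-respʳ (ℓ-sym x v) (exchange-≤ uv x≢v x~u))))
      ... | inj₂ x~v = inj₂ (≤-respˡ (‖-‖²-sym (point u) (point v)) (dist≤⇒‖-‖²≤ (point u) (point v) (point x)
        (≤-respˡ (ℓ-sym v u) (≤-respʳ (ℓ-sym x u) (exchange-≤ (Adj-sym G uv) x≢u
          (Star.map (λ ij → let ij′ , ¬J = remove⁻ G ij in remove⁺ G ij′ (¬J ∘ Sum.swap)) x~v))))))

      R : Pred (Fin n) 0ℓ
      R = Identified T G

      -- For the midpoint m, Stewart's theorem gives D(m, x) - D(m, i) = (D(i, x) + D(j, x) - E) /
      -- 2. By the exchange property one of D(i, x), D(j, x) is at least `E`; the other is positive
      -- because training points are distinct.
      tree-edge⇒wall : ∀ {i j} → Adj G i j → ∃[ u ] D T u j ≤ D T u i × (∀ x → x ≢ i → x ≢ j → D T u i < D T u x)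
      tree-edge⇒wall {i} {j} ij = m , ≤-reflexive (trans Dmj≈ (sym Dmi≈)) , λ x x≢i x≢j → <-by (gap x) (0<gap x≢i x≢j)
        where
        h = 2# ⁻¹
        0<h = ⁻¹-pos 0<2
        1-h≈h : 1# - h ≈ h
        1-h≈h = trans (+-congʳ (sym (*-inverseʳ 2# (pos⇒≉0 0<2)))) (solve 1 (λ h → con (+ 2) :* h :- h :=
             h) refl h)
        m : Point d
        m k = point i k + h * (point j k - point i k)
        E = ‖ point j - point i ‖²
        Dm : ∀ x → D T m x ≈ h * D T (point i) x + h * D T (point j) x - h * h * E
        Dm x = begin
          D T m x
            ≈⟨ stewart (point i) (point j) (point x) h ⟩
          (1# - h) * D T (point i) x + h * D T (point j) x + (h * h - h) * ‖ point i - point j ‖²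
            ≈⟨ +-cong (+-congʳ (*-congʳ 1-h≈h)) (*-cong
                 (trans (solve 1 (λ h → h :* h :- h :=
                      :- (h :* (con (+ 1) :- h))) refl h) (-‿cong (*-congˡ 1-h≈h)))
                 (‖-‖²-sym (point i) (point j))) ⟩
          h * D T (point i) x + h * D T (point j) x + - (h * h) * E
            ≈⟨ +-congˡ (solve 2 (λ h e → :- (h :* h) :* e := :- (h :* h :* e)) refl h E) ⟩
          h * D T (point i) x + h * D T (point j) x - h * h * E ∎
        Dmi≈ : D T m i ≈ h * E - h * h * E
        Dmi≈ = trans (Dm i) (+-congʳ (trans (+-congʳ (trans (*-congˡ (‖x-x‖²≈0 (point i))) (zeroʳ h))) (+-identityˡ _)))
        Dmj≈ : D T m j ≈ h * E - h * h * E
        Dmj≈ = trans (Dm j) (+-congʳ (trans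
          (+-cong (*-congˡ (‖-‖²-sym (point i) (point j))) (trans (*-congˡ (‖x-x‖²≈0 (point j))) (zeroʳ h)))
              (+-identityʳ _)))
        gap : ∀ x → D T m x - D T m i ≈ h * (D T (point i) x + D T (point j) x - E)
        gap x = trans (+-cong (Dm x) (-‿cong Dmi≈))
          (solve 4 (λ h a b e → (h :* a :+ h :* b :- h :* h :* e) :- (h :* e :- h :* h :* e) :=
               h :* (a :+ b :- e)) refl h _ _ E)
        0<gap : ∀ {x} → x ≢ i → x ≢ j → 0# < h * (D T (point i) x + D T (point j) x - E)
        0<gap {x} x≢i x≢j with tree-edge-≤ ij x≢i x≢j
        ... | inj₁ E≤jx = *-pos 0<h (<-respʳ (solve 3 (λ a b e → a :+ (b :- e) := a :+ b :- e) refl _ _ E)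
          (+-pos-nonneg (‖-‖²-pos (point-≢ T (x≢i ∘ ≡.sym))) (x≤y⇒0≤y-x E≤jx)))
        ... | inj₂ E≤ix = *-pos 0<h (<-respʳ (solve 3 (λ a b e → b :+ (a :- e) := a :+ b :- e) refl _ _ E)
          (+-pos-nonneg (‖-‖²-pos (point-≢ T (x≢j ∘ ≡.sym))) (x≤y⇒0≤y-x E≤ix)))

      Identified⇒Relevant : ∀ {i} → R i → Relevant T R i
      Identified⇒Relevant (initial ij i≢j) =
        let u , Dj≤Di , Di<Dx = tree-edge⇒wall ij
        in wall⇒Relevant T u (initial (Adj-sym G ij) (i≢j ∘ ≡.sym)) (initial ij i≢j) i≢j Dj≤Di
             λ x _ x≢j x≢i → Di<Dx x x≢i (x≢j ∘ ≡.cong class)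
      Identified⇒Relevant (step y r∈R (centre ≡.refl _) _) = Identified⇒Relevant r∈R
      Identified⇒Relevant s∈R@(step y r∈R (inverted s≢r y≋) extreme) =
        let u , Dr≤Ds , Ds<Dx = Extreme⇒wall T s≢r y≋ extreme
        in wall⇒Relevant T u r∈R s∈R s≢r Dr≤Ds λ x _ → Ds<Dx x

      -- Closure of `R` under `step` puts the extreme points of S_t into `R`, where `t` is already
      -- nearest.
      nearest-Identified : ∀ {t q} → t ∈ Nearest T R q → ∀ x → class x ≢ class t → D T q t ≤ D T q x
      nearest-Identified {t} {q} t∈ = extreme-points-suffice T t q λ i y i≢t sp extreme →
        Nearest⇒D≤ T {R} {q} t∈ (step y (proj₁ t∈) sp extreme)

      bichromatic-path : ∀ {i j} → Star (Adj G) i j → class i ≢ class j → ∃ R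
      bichromatic-path ε i≢i = contradiction ≡.refl i≢i
      bichromatic-path {i} (_◅_ {j = k} ik path) i≢j with em {P = class i ≡ class k}
      ... | yes i≡k = bichromatic-path path (i≢j ∘ ≡.trans i≡k)
      ... | no  i≢k = i , initial ik i≢k

      -- A point t of R nearest to q would, if t ≠ r, be among the nearest points of T
      -- or of T ∖ r, yet agree with neither classification.
      Relevant⇒Identified : ∀ {r} → Relevant T U r → R r
      Relevant⇒Identified {r} (_ , q , c , c′ , ((i , i∈) , all-c) , ((j , j∈) , all-c′) , c≢c′)
        -- The two inferred classes differ, so some tree edge is bichromatic and `R` has a point
        -- nearest to `q`.
        with bichromatic-path (connected i j) (λ i≡j → c≢c′ (≡.trans (≡.sym (all-c i i∈)) (≡.trans i≡j (all-c′ j j∈))))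
      ... | R≠∅ with argmin (D T q) R R≠∅
      ...   | t , t∈R , t-min with t ≟ r
      ...     | yes ≡.refl = t∈R
      ...     | no  t≢r    = contradiction (≡.trans (≡.sym t≡c) t≡c′) c≢c′
        where
        t∈ : t ∈ Nearest T R q
        t∈ = D≤⇒Nearest T t∈R t-min
        -- A nearest point of another class cannot beat `t`, so `t` ties with it; an unambiguous
        -- classification of `q` must then include the class of `t`.
        nearest-of : ∀ {X : Pred (Fin n) 0ℓ} {k} → k ∈ Nearest T X q → t ∈ X → class k ≢ class t → t ∈ Nearest T X q
        nearest-of {k = k} k∈ t∈X k≢t = D≤⇒Nearest T t∈X λ x x∈X →
          ≤-trans (nearest-Identified t∈ k k≢t) (Nearest⇒D≤ T k∈ x∈X)
        t≡c : class t ≡ c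
        t≡c with em {P = class i ≡ class t}
        ... | yes i≡t = ≡.trans (≡.sym i≡t) (all-c i i∈)
        ... | no  i≢t = all-c t (nearest-of i∈ _ i≢t)
        t≡c′ : class t ≡ c′
        t≡c′ with em {P = class j ≡ class t}
        ... | yes j≡t = ≡.trans (≡.sym j≡t) (all-c′ j j∈)
        ... | no  j≢t = all-c′ t (nearest-of j∈ (_ , t≢r) j≢t)

lemma11 : ExcludedMiddle 0ℓ → (ℝ : RealNumbers) →
    let open NearestNeighbor ℝ in
    ∀ {d n : ℕ} {K : Set} (T : TrainingSet d n K) (G : Graph n) →
    IsEuclideanMST T G →
    (∀ i → Relevant T U i → Identified T G i) ×
    (∀ i → Relevant T (Identified T G) i ⇔ Identified T G i)
lemma11 em ℝ T G mst =
  -- Membership is the first component of `Relevant`, which gives the forward implication.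
  (λ _ → Relevant⇒Identified T mst) , λ _ → mk⇔ proj₁ (Identified⇒Relevant T mst)
  where open Relevance em ℝ
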